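{- There exist absolute constants $c>0$ and $c'>0$ such that the following holds for every $\varepsilon\in(0,1)$. Every $n$-vertex ordered graph $G$ which is $\varepsilon$-far from being induced $D$-free contains at least $c'\varepsilon^{c} n^3$ induced copies of $D$.
   Context: An ordered graph is a graph with a linear order on its vertex set. $D$ is the ordered graph with vertices $x<y<z$ and edges $\{x,y\},\{x,z\}$ (and non-edge $\{y,z\}$). An induced copy of $D$ in an ordered graph $G$ is a triple of vertices $u<v<w$ of $G$ with $\{u,v\},\{u,w\}\in E(G)$ and $\{v,w\}\notin E(G)$. $G$ is $\varepsilon$-far from being induced $D$-free if one must add/delete at least $\varepsilon n^2$ edges to obtain an ordered graph with no induced copy of $D$. -}

module Defs where

open import Data.Nat using (ℕ; zero; suc) renaming (_<ᵇ_ to _<ℕᵇ_)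
open import Data.Bool using (Bool; true; false; _∧_; not; _xor_; if_then_else_)
open import Data.Fin using (Fin; toℕ)
open import Data.List using (List; map; allFin)
open import Data.Nat.ListAction using (sum)
open import Data.Integer using (+_)
open import Data.Rational using (ℚ; _/_; _*_; 1ℚ)
open import Relation.Binary.PropositionalEquality using (_≡_)

-- An ordered graph on n vertices: vertex set Fin n with its natural order,
-- adjacency a symmetric irreflexive Boolean relation (simple graph).
record OrdGraph (n : ℕ) : Set where
  field
    adj    : Fin n → Fin n → Bool
    sym    : ∀ i j → adj i j ≡ adj j i
    irrefl : ∀ i → adj i i ≡ false
open OrdGraph public

_<ᵛ_ : {n : ℕ} → Fin n → Fin n → Bool
i <ᵛ j = toℕ i <ℕᵇ toℕ j

isD : {n : ℕ} → OrdGraph n → Fin n → Fin n → Fin n → Bool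
isD G u v w =
  (u <ᵛ v) ∧ (v <ᵛ w) ∧ adj G u v ∧ adj G u w ∧ not (adj G v w)

indicator : Bool → ℕ
indicator b = if b then 1 else 0

countD : {n : ℕ} → OrdGraph n → ℕ
countD {n} G =
  sum (map (λ u → sum (map (λ v → sum (map (λ w → indicator (isD G u v w))
    (allFin n))) (allFin n))) (allFin n))

InducedDFree : {n : ℕ} → OrdGraph n → Set
InducedDFree {n} H = ∀ (u v w : Fin n) → isD H u v w ≡ false

dist : {n : ℕ} → OrdGraph n → OrdGraph n → ℕ
dist {n} G H =
  sum (map (λ u → sum (map (λ v → indicator ((u <ᵛ v) ∧ (adj G u v xor adj H u v)))
    (allFin n))) (allFin n))

ℕtoℚ : ℕ → ℚ
ℕtoℚ k = (+ k) / 1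

_^ℚ_ : ℚ → ℕ → ℚ
q ^ℚ zero  = 1ℚ
q ^ℚ suc k = q * (q ^ℚ k)

EpsFar : {n : ℕ} → ℚ → OrdGraph n → Set
EpsFar {n} ε G =
  ∀ (H : OrdGraph n) → InducedDFree H →
    Data.Rational._≤_ (ε * (ℕtoℚ n ^ℚ 2)) (ℕtoℚ (dist G H))

{-# OPTIONS --safe #-}
module Submission where

-- An ordered graph is D-free iff every forward neighbourhood is a clique. In a D-free graph the
-- forward neighbours of u other than the first one, π(u), are forward neighbours of π(u); hence the
-- chain u, π(u), π²(u), … passes through all forward neighbours of u, and the chains of adjacent
-- vertices merge.
--
-- A random sample of poly(1/ε) vertices together with two further vertices u, v spans a D-free
-- graph, except for few pairs u, v, unless G has many copies of D. Let π refer to first neighbours in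
-- the sample, cut the vertex order into k blocks, and let e_j(u) be the first vertex of the chain of
-- u beyond block j. Make u < v, with v in block j, adjacent when e_j(u) = e_j(v) and every e_i(u)
-- with i ≥ block(u) lying in a block before j is adjacent to v in G. Since equality of e_i is
-- inherited by e_j for j ≥ i, this relation is exactly D-free.
--
-- It differs from G in few pairs, once vertices without a backward neighbour in a smaller second
-- sample S₀ lose their backward edges and keep only those forward edges that are edges of G. Missing
-- edges come from forward neighbourhoods which the sample misses beyond v within the block of v.
-- Superfluous edges uv with t ∈ S₀ adjacent to u are confined, for fixed t and v, to two blocks.

open import Defs
open import Data.Nat using (ℕ)
open import Data.Product using (Σ; _×_)

module Counting where

  open import Data.Bool using (Bool; true; false; _∧_; _∨_; _xor_)
  import Data.Bool.Properties as Bool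
  open import Data.Fin as Fin using (Fin; toℕ)
  open import Data.Fin.Induction using (>-wellFounded)
  import Data.Fin.Properties as Fin
  open import Data.List using (List; []; _∷_; _++_; map; concatMap; allFin; length; upTo)
  open import Data.List.Membership.Propositional using (_∈_; lose; find)
  open import Data.List.Membership.Propositional.Properties
    using (∈-++⁺ˡ; ∈-++⁺ʳ; ∈-upTo⁺; ∈-allFin)
  import Data.List.Membership.DecPropositional as DecMembership
  open import Data.List.Properties using (map-tabulate; length-upTo)
  open import Data.List.Relation.Unary.All using (All; all?)
  open import Data.List.Relation.Unary.All.Properties using (¬Any⇒All¬)
  open import Data.List.Relation.Unary.Any using (Any; here; there; any?)
  open import Data.Maybe using (Maybe; just; nothing; maybe)
  open import Data.Maybe.Properties using (≡-dec)
  open import Data.Nat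
  open import Data.Nat.DivMod
  open import Data.Nat.ListAction using (sum)
  open import Data.Nat.Properties
  open import Data.Nat.Tactic.RingSolver using (solve-∀)
  open import Data.Product using (∃; _,_; proj₁; proj₂)
  open import Data.Sum using (_⊎_; inj₁; inj₂)
  open import Function using (_∘_; it; Equivalence)
  open import Induction.WellFounded using (Acc; acc)
  open import Relation.Binary.PropositionalEquality hiding (sym)
  import Relation.Binary.PropositionalEquality as ≡
  open import Relation.Nullary using (¬_; Dec; yes; no; does; contradiction)
  open import Relation.Nullary.Decidable using (_×-dec_; _⊎-dec_; _→-dec_; ¬?; dec-true; toSum)
  open import Relation.Unary using (Decidable)

  -- Finite sums and indicators

  ∑ : {A : Set} → List A → (A → ℕ) → ℕ
  ∑ xs f = sum (map f xs)

  module _ {A : Set} where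

    ∑-mono-∈ : (xs : List A) {f g : A → ℕ} → (∀ x → x ∈ xs → f x ≤ g x) → ∑ xs f ≤ ∑ xs g
    ∑-mono-∈ []       h = z≤n
    ∑-mono-∈ (x ∷ xs) h = +-mono-≤ (h x (here refl)) (∑-mono-∈ xs λ y y∈ → h y (there y∈))

    ∑-mono : (xs : List A) {f g : A → ℕ} → (∀ x → f x ≤ g x) → ∑ xs f ≤ ∑ xs g
    ∑-mono xs h = ∑-mono-∈ xs λ x _ → h x

    ∑-cong : (xs : List A) {f g : A → ℕ} → (∀ x → f x ≡ g x) → ∑ xs f ≡ ∑ xs g
    ∑-cong []       h = refl
    ∑-cong (x ∷ xs) h = cong₂ _+_ (h x) (∑-cong xs h)

    ∑-+ : (xs : List A) (f g : A → ℕ) → ∑ xs (λ x → f x + g x) ≡ ∑ xs f + ∑ xs g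
    ∑-+ []       f g = refl
    ∑-+ (x ∷ xs) f g rewrite ∑-+ xs f g = interchange (f x) (g x) (∑ xs f) (∑ xs g)
      where
      interchange : ∀ a b c d → (a + b) + (c + d) ≡ (a + c) + (b + d)
      interchange = solve-∀

    ∑-*ˡ : (xs : List A) (c : ℕ) (f : A → ℕ) → ∑ xs (λ x → c * f x) ≡ c * ∑ xs f
    ∑-*ˡ []       c f = ≡.sym (*-zeroʳ c)
    ∑-*ˡ (x ∷ xs) c f rewrite ∑-*ˡ xs c f = ≡.sym (*-distribˡ-+ c (f x) (∑ xs f))

    ∑-*ʳ : (xs : List A) (c : ℕ) (f : A → ℕ) → ∑ xs (λ x → f x * c) ≡ ∑ xs f * c
    ∑-*ʳ xs c f = begin
      ∑ xs (λ x → f x * c)  ≡⟨ ∑-cong xs (λ x → *-comm (f x) c) ⟩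
      ∑ xs (λ x → c * f x)  ≡⟨ ∑-*ˡ xs c f ⟩
      c * ∑ xs f            ≡⟨ *-comm c _ ⟩
      ∑ xs f * c            ∎
      where open ≡-Reasoning

    ∑-const : (xs : List A) (c : ℕ) → ∑ xs (λ _ → c) ≡ length xs * c
    ∑-const []       c = refl
    ∑-const (x ∷ xs) c = cong (c +_) (∑-const xs c)

    ∑-zero : (xs : List A) {f : A → ℕ} → (∀ x → f x ≡ 0) → ∑ xs f ≡ 0
    ∑-zero xs h = trans (∑-cong xs h) (trans (∑-const xs 0) (*-zeroʳ (length xs)))

    term≤∑ : (xs : List A) (f : A → ℕ) {x : A} → x ∈ xs → f x ≤ ∑ xs f
    term≤∑ (y ∷ xs) f (here refl) = m≤m+n (f y) _
    term≤∑ (y ∷ xs) f (there x∈)  = ≤-trans (term≤∑ xs f x∈) (m≤n+m _ (f y))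

    ∑-++ : (xs ys : List A) (f : A → ℕ) → ∑ (xs ++ ys) f ≡ ∑ xs f + ∑ ys f
    ∑-++ []       ys f = refl
    ∑-++ (x ∷ xs) ys f rewrite ∑-++ xs ys f = ≡.sym (+-assoc (f x) _ _)

    exists≤average : (xs : List A) (f : A → ℕ) → 0 < length xs →
                     ∃ λ x → length xs * f x ≤ ∑ xs f
    exists≤average (x ∷ [])     f _ = x , ≤-refl
    exists≤average (x ∷ y ∷ xs) f _ with exists≤average (y ∷ xs) f z<s
    ... | z , h with ≤-total (f x) (f z)
    ... | inj₁ x≤z = x , +-monoʳ-≤ (f x) (≤-trans (*-monoʳ-≤ (length (y ∷ xs)) x≤z) h)
    ... | inj₂ z≤x = z , +-mono-≤ z≤x h

  ∑-swap : {A B : Set} (xs : List A) (ys : List B) (f : A → B → ℕ) →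
           ∑ xs (λ x → ∑ ys (f x)) ≡ ∑ ys (λ y → ∑ xs (λ x → f x y))
  ∑-swap []       ys f = ≡.sym (∑-zero ys λ _ → refl)
  ∑-swap (x ∷ xs) ys f rewrite ∑-swap xs ys f = ≡.sym (∑-+ ys (f x) _)

  ∑-map : {A B : Set} (xs : List A) (g : A → B) (f : B → ℕ) → ∑ (map g xs) f ≡ ∑ xs (f ∘ g)
  ∑-map []       g f = refl
  ∑-map (x ∷ xs) g f = cong (f (g x) +_) (∑-map xs g f)

  ∑-concatMap : {A B : Set} (xs : List A) (g : A → List B) (f : B → ℕ) →
                ∑ (concatMap g xs) f ≡ ∑ xs (λ x → ∑ (g x) f)
  ∑-concatMap []       g f = refl
  ∑-concatMap (x ∷ xs) g f = trans (∑-++ (g x) _ f) (cong (∑ (g x) f +_) (∑-concatMap xs g f))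

  ∑-suc : (n : ℕ) (f : Fin (suc n) → ℕ) →
          ∑ (allFin (suc n)) f ≡ f Fin.zero + ∑ (allFin n) (f ∘ Fin.suc)
  ∑-suc n f = cong (λ xs → f Fin.zero + sum xs)
    (trans (map-tabulate Fin.suc f) (≡.sym (map-tabulate (λ i → i) (f ∘ Fin.suc))))

  ∑-ones : (n : ℕ) (c : ℕ) → ∑ (allFin n) (λ _ → c) ≡ n * c
  ∑-ones zero    c = refl
  ∑-ones (suc n) c = trans (∑-suc n λ _ → c) (cong (c +_) (∑-ones n c))

  ind : {P : Set} → Dec P → ℕ
  ind P? = indicator (does P?)

  module _ {P Q : Set} where

    ind-mono : (P? : Dec P) (Q? : Dec Q) → (P → Q) → ind P? ≤ ind Q?
    ind-mono (no _)  Q?      h = z≤n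
    ind-mono (yes p) (yes _) h = ≤-refl
    ind-mono (yes p) (no ¬q) h = contradiction (h p) ¬q

    ind-× : (P? : Dec P) (Q? : Dec Q) → ind (P? ×-dec Q?) ≡ ind P? * ind Q?
    ind-× (no _)  Q? = refl
    ind-× (yes _) Q? = ≡.sym (+-identityʳ _)

  module _ {P : Set} where

    ind-yes : (P? : Dec P) → P → ind P? ≡ 1
    ind-yes (yes _) p = refl
    ind-yes (no ¬p) p = contradiction p ¬p

    ind-no : (P? : Dec P) → ¬ P → ind P? ≡ 0
    ind-no (yes p) ¬p = contradiction p ¬p
    ind-no (no _)  ¬p = refl

  -- Uniform random samples as sums over all tuples

  tuples : (n m : ℕ) → List (List (Fin n))
  tuples n zero    = [] ∷ []
  tuples n (suc m) = concatMap (λ x → map (x ∷_) (tuples n m)) (allFin n)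

  module _ (n : ℕ) where

    ∑-tuples-suc : (m : ℕ) (f : List (Fin n) → ℕ) →
      ∑ (tuples n (suc m)) f ≡ ∑ (allFin n) (λ x → ∑ (tuples n m) (λ S → f (x ∷ S)))
    ∑-tuples-suc m f = trans (∑-concatMap (allFin n) _ f)
      (∑-cong (allFin n) λ x → ∑-map (tuples n m) (x ∷_) f)

    -- Samples are plain lists, so that `S₀ ++ S` and `u ∷ v ∷ S` stay in one type; the length is
    -- therefore handed over as a hypothesis.
    ∑-tuples-mono : (m : ℕ) {f g : List (Fin n) → ℕ} →
      (∀ S → length S ≡ m → f S ≤ g S) → ∑ (tuples n m) f ≤ ∑ (tuples n m) g
    ∑-tuples-mono zero    h = +-monoˡ-≤ 0 (h [] refl)
    ∑-tuples-mono (suc m) {f} {g} h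
      rewrite ∑-tuples-suc m f | ∑-tuples-suc m g =
      ∑-mono (allFin n) λ x → ∑-tuples-mono m λ S eq → h (x ∷ S) (cong suc eq)

    ∑-tuples-const : (m c : ℕ) → ∑ (tuples n m) (λ _ → c) ≡ n ^ m * c
    ∑-tuples-const zero    c = refl
    ∑-tuples-const (suc m) c = begin
      ∑ (tuples n (suc m)) (λ _ → c)                 ≡⟨ ∑-tuples-suc m _ ⟩
      ∑ (allFin n) (λ _ → ∑ (tuples n m) (λ _ → c))  ≡⟨ ∑-ones n _ ⟩
      n * ∑ (tuples n m) (λ _ → c)                   ≡⟨ cong (n *_) (∑-tuples-const m c) ⟩
      n * (n ^ m * c)                                ≡⟨ *-assoc n (n ^ m) c ⟨
      n ^ suc m * c                                  ∎
      where open ≡-Reasoning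

    length-tuples : (m : ℕ) → length (tuples n m) ≡ n ^ m
    length-tuples m = begin
      length (tuples n m)              ≡⟨ *-identityʳ _ ⟨
      length (tuples n m) * 1          ≡⟨ ∑-const (tuples n m) 1 ⟨
      ∑ (tuples n m) (λ _ → 1)         ≡⟨ ∑-tuples-const m 1 ⟩
      n ^ m * 1                        ≡⟨ *-identityʳ _ ⟩
      n ^ m                            ∎
      where open ≡-Reasoning

    ∑-tuples-+ : (a b : ℕ) (f : List (Fin n) → ℕ) →
      ∑ (tuples n (a + b)) f ≡ ∑ (tuples n a) (λ S → ∑ (tuples n b) (λ T → f (S ++ T)))
    ∑-tuples-+ zero    b f = ≡.sym (+-identityʳ _)
    ∑-tuples-+ (suc a) b f = begin
      ∑ (tuples n (suc (a + b))) f
        ≡⟨ ∑-tuples-suc (a + b) f ⟩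
      ∑ (allFin n) (λ x → ∑ (tuples n (a + b)) (λ S → f (x ∷ S)))
        ≡⟨ ∑-cong (allFin n) (λ x → ∑-tuples-+ a b (λ S → f (x ∷ S))) ⟩
      ∑ (allFin n) (λ x → ∑ (tuples n a) (λ S → ∑ (tuples n b) (λ T → f (x ∷ S ++ T))))
        ≡⟨ ∑-tuples-suc a _ ⟨
      ∑ (tuples n (suc a)) (λ S → ∑ (tuples n b) (λ T → f (S ++ T))) ∎
      where open ≡-Reasoning

    -- Independence of the entries. Applied to the complement of a set, it gives the probability
    -- that a sample misses that set.
    ∑-tuples-all : (m : ℕ) {P : Fin n → Set} (P? : Decidable P) →
      ∑ (tuples n m) (λ S → ind (all? P? S)) ≡ ∑ (allFin n) (λ x → ind (P? x)) ^ m
    ∑-tuples-all zero    P? = refl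
    ∑-tuples-all (suc m) P? = begin
      ∑ (tuples n (suc m)) (λ S → ind (all? P? S))
        ≡⟨ ∑-tuples-suc m _ ⟩
      ∑ (allFin n) (λ x → ∑ (tuples n m) (λ S → ind (P? x ×-dec all? P? S)))
        ≡⟨ ∑-cong (allFin n) (λ x → trans (∑-cong (tuples n m) (λ S → ind-× (P? x) (all? P? S)))
                                          (∑-*ˡ (tuples n m) (ind (P? x)) _)) ⟩
      ∑ (allFin n) (λ x → ind (P? x) * ∑ (tuples n m) (λ S → ind (all? P? S)))
        ≡⟨ ∑-*ʳ (allFin n) _ _ ⟩
      ∑ (allFin n) (λ x → ind (P? x)) * ∑ (tuples n m) (λ S → ind (all? P? S))
        ≡⟨ cong (∑ (allFin n) (λ x → ind (P? x)) *_) (∑-tuples-all m P?) ⟩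
      ∑ (allFin n) (λ x → ind (P? x)) ^ suc m ∎
      where open ≡-Reasoning

  -- Missed elements of a random sample

  -- The left side consists of the two leading terms of the binomial expansion of the right side.
  bernoulli : ∀ m y → suc m * y ^ m + y ^ suc m ≤ suc y ^ suc m
  bernoulli zero    y = ≤-refl
  bernoulli (suc m) y = begin
    suc (suc m) * y ^ suc m + y ^ suc (suc m)
      ≡⟨ expand m y (y ^ m) ⟩
    y * (suc m * y ^ m + y * y ^ m) + y * y ^ m
      ≤⟨ +-mono-≤ (*-monoʳ-≤ y (bernoulli m y)) (^-monoˡ-≤ (suc m) (n≤1+n y)) ⟩
    y * suc y ^ suc m + suc y ^ suc m
      ≡⟨ +-comm (y * suc y ^ suc m) _ ⟩
    suc y ^ suc (suc m) ∎
    where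
    open ≤-Reasoning
    expand : ∀ m y p → suc (suc m) * (y * p) + y * (y * p) ≡ y * (suc m * p + y * p) + y * p
    expand = solve-∀

  module _ {n : ℕ} {A : Fin n → Set} (A? : Decidable A) where

    Beyond : Fin n → Fin n → Set
    Beyond v s = A s × v Fin.≤ s

    beyond? : ∀ v → Decidable (Beyond v)
    beyond? v s = A? s ×-dec (v Fin.≤? s)

    -- The order in `Beyond` is not strict, so an element of `A` that is itself sampled is never
    -- missed.
    Missed : List (Fin n) → Fin n → Set
    Missed S v = A v × All (¬_ ∘ Beyond v) S

    missed? : ∀ S → Decidable (Missed S)
    missed? S v = A? v ×-dec all? (¬? ∘ beyond? v) S

  -- The offset z keeps track of the vertices below the current one, which are never beyond it;
  -- removing the least vertex then telescopes along bernoulli.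
  telescope : ∀ m n z {A : Fin n → Set} (A? : Decidable A) →
    suc m * ∑ (allFin n) (λ v → ind (A? v) * (z + ∑ (allFin n) (λ s → ind (¬? (beyond? A? v s)))) ^ m)
      + (z + ∑ (allFin n) (λ s → ind (¬? (A? s)))) ^ suc m
    ≤ (z + n) ^ suc m
  telescope m zero    z A? rewrite *-zeroʳ m = ≤-refl
  telescope m (suc n) z {A} A? = begin
    suc m * ∑ (allFin (suc n)) f + (z + ∑ (allFin (suc n)) (λ s → ind (¬? (A? s)))) ^ suc m
      ≡⟨ cong₂ (λ a b → suc m * a + (z + b) ^ suc m) (∑-suc n f) (∑-suc n _) ⟩
    suc m * (f Fin.zero + ∑ (allFin n) (f ∘ Fin.suc)) + (z + (ind (¬? (A? Fin.zero)) + w)) ^ suc m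
      ≡⟨ cong (λ a → suc m * (f Fin.zero + a) + (z + (ind (¬? (A? Fin.zero)) + w)) ^ suc m) (∑-cong (allFin n) shift) ⟩
    suc m * (f Fin.zero + F) + (z + (ind (¬? (A? Fin.zero)) + w)) ^ suc m
      ≤⟨ first (A? Fin.zero) refl ⟩
    suc m * F + (suc z + w) ^ suc m
      ≤⟨ telescope m n (suc z) (A? ∘ Fin.suc) ⟩
    (suc z + n) ^ suc m
      ≡⟨ cong (_^ suc m) (+-suc z n) ⟨
    (z + suc n) ^ suc m ∎
    where
    open ≤-Reasoning
    f : Fin (suc n) → ℕ
    f v = ind (A? v) * (z + ∑ (allFin (suc n)) (λ s → ind (¬? (beyond? A? v s)))) ^ m
    w = ∑ (allFin n) (λ s → ind (¬? (A? (Fin.suc s))))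
    g : Fin n → ℕ
    g v = ind (A? (Fin.suc v)) *
          (suc z + ∑ (allFin n) (λ s → ind (¬? (beyond? (A? ∘ Fin.suc) v s)))) ^ m
    F = ∑ (allFin n) g
    same : ∀ v s → ind (¬? (beyond? A? (Fin.suc v) (Fin.suc s))) ≡ ind (¬? (beyond? (A? ∘ Fin.suc) v s))
    same v s = ≤-antisym
      (ind-mono (¬? (beyond? A? _ _)) (¬? (beyond? (A? ∘ Fin.suc) v s)) λ h (a , l) → h (a , s≤s l))
      (ind-mono (¬? (beyond? (A? ∘ Fin.suc) v s)) (¬? (beyond? A? _ _)) λ h (a , l) → h (a , s≤s⁻¹ l))
    shift : ∀ v → f (Fin.suc v) ≡ g v
    shift v = cong (λ a → ind (A? (Fin.suc v)) * a ^ m) (begin-equality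
      z + ∑ (allFin (suc n)) (λ s → ind (¬? (beyond? A? (Fin.suc v) s)))
        ≡⟨ cong (z +_) (∑-suc n _) ⟩
      z + (ind (¬? (beyond? A? (Fin.suc v) Fin.zero))
        + ∑ (allFin n) (λ s → ind (¬? (beyond? A? (Fin.suc v) (Fin.suc s)))))
        ≡⟨ cong₂ (λ a b → z + (a + b)) (ind-yes (¬? (beyond? A? (Fin.suc v) Fin.zero)) λ { (_ , ()) })
                                        (∑-cong (allFin n) (same v)) ⟩
      z + suc (∑ (allFin n) (λ s → ind (¬? (beyond? (A? ∘ Fin.suc) v s))))
        ≡⟨ +-suc z _ ⟩
      suc z + _ ∎)
    none-below : A Fin.zero → ∑ (allFin (suc n)) (λ s → ind (¬? (beyond? A? Fin.zero s))) ≡ w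
    none-below a = trans (∑-suc n _) (cong₂ _+_
      (ind-no (¬? (beyond? A? Fin.zero Fin.zero)) λ h → h (a , z≤n))
      (∑-cong (allFin n) λ s → ≤-antisym
        (ind-mono (¬? (beyond? A? Fin.zero (Fin.suc s))) (¬? (A? (Fin.suc s))) λ h a → h (a , z≤n))
        (ind-mono (¬? (A? (Fin.suc s))) (¬? (beyond? A? Fin.zero (Fin.suc s))) λ h (a , _) → h a)))
    first : (d : Dec (A Fin.zero)) → A? Fin.zero ≡ d →
      suc m * (f Fin.zero + F) + (z + (ind (¬? (A? Fin.zero)) + w)) ^ suc m
        ≤ suc m * F + (suc z + w) ^ suc m
    first (yes a) eq rewrite none-below a | eq | +-identityʳ ((z + w) ^ m) = begin
      suc m * ((z + w) ^ m + F) + (z + w) ^ suc m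
        ≡⟨ arrange (suc m) ((z + w) ^ m) F _ ⟩
      suc m * F + (suc m * (z + w) ^ m + (z + w) ^ suc m)
        ≤⟨ +-monoʳ-≤ (suc m * F) (bernoulli m (z + w)) ⟩
      suc m * F + (suc z + w) ^ suc m ∎
      where
      arrange : ∀ c p q r → c * (p + q) + r ≡ c * q + (c * p + r)
      arrange = solve-∀
    first (no ¬a) eq rewrite eq | +-suc z w = ≤-refl

  -- The r-th element of `A` from the top is missed with probability (1 - r/n)^m. Summed over r this
  -- is at most n/(m+1), whatever the size of `A`.
  ∑-missed : ∀ n m {A : Fin n → Set} (A? : Decidable A) →
    suc m * ∑ (tuples n m) (λ S → ∑ (allFin n) (λ v → ind (missed? A? S v))) ≤ n ^ suc m
  ∑-missed n m A? = begin
    suc m * ∑ (tuples n m) (λ S → ∑ (allFin n) (λ v → ind (missed? A? S v)))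
      ≡⟨ cong (suc m *_) (∑-swap (tuples n m) (allFin n) _) ⟩
    suc m * ∑ (allFin n) (λ v → ∑ (tuples n m) (λ S → ind (missed? A? S v)))
      ≡⟨ cong (suc m *_) (∑-cong (allFin n) single) ⟩
    suc m * ∑ (allFin n) (λ v → ind (A? v) * ∑ (allFin n) (λ s → ind (¬? (beyond? A? v s))) ^ m)
      ≤⟨ m≤m+n _ _ ⟩
    suc m * ∑ (allFin n) (λ v → ind (A? v) * ∑ (allFin n) (λ s → ind (¬? (beyond? A? v s))) ^ m)
      + ∑ (allFin n) (λ s → ind (¬? (A? s))) ^ suc m
      ≤⟨ telescope m n 0 A? ⟩
    n ^ suc m ∎
    where
    open ≤-Reasoning
    single : ∀ v → ∑ (tuples n m) (λ S → ind (missed? A? S v)) ≡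
                   ind (A? v) * ∑ (allFin n) (λ s → ind (¬? (beyond? A? v s))) ^ m
    single v = trans (∑-cong (tuples n m) λ S → ind-× (A? v) (all? (¬? ∘ beyond? A? v) S))
      (trans (∑-*ˡ (tuples n m) (ind (A? v)) _)
             (cong (ind (A? v) *_) (∑-tuples-all n m (¬? ∘ beyond? A? v))))

  -- Least elements and intervals

  Least : {n : ℕ} → (Fin n → Set) → Fin n → Set
  Least P u = P u × (∀ v → P v → u Fin.≤ v)

  least? : ∀ {n} {P : Fin n → Set} → Decidable P → ∃ (Least P) ⊎ (∀ v → ¬ P v)
  least? {zero}  P? = inj₂ λ ()
  least? {suc n} P? with P? Fin.zero
  ... | yes p = inj₁ (Fin.zero , p , λ _ _ → z≤n)
  ... | no ¬p with least? (P? ∘ Fin.suc)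
  ... | inj₁ (u , pu , least) =
    inj₁ (Fin.suc u , pu , λ { Fin.zero p → contradiction p ¬p ; (Fin.suc v) p → s≤s (least v p) })
  ... | inj₂ none = inj₂ λ { Fin.zero → ¬p ; (Fin.suc v) → none v }

  -- The offset z makes the induction on n go through.
  interval-size : ∀ n z a l →
    ∑ (allFin n) (λ v → ind ((a ≤? z + toℕ v) ×-dec (z + toℕ v <? a + l))) ≤ l
  interval-size zero    z a l = z≤n
  interval-size (suc n) z a l = begin
    ∑ (allFin (suc n)) f                              ≡⟨ ∑-suc n f ⟩
    f Fin.zero + ∑ (allFin n) (f ∘ Fin.suc)           ≡⟨ cong (f Fin.zero +_) (∑-cong (allFin n) shift) ⟩
    f Fin.zero + ∑ (allFin n) (g a l)                 ≤⟨ first (a ≤? z + 0) (z + 0 <? a + l) ⟩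
    l ∎
    where
    open ≤-Reasoning
    f : Fin (suc n) → ℕ
    f v = ind ((a ≤? z + toℕ v) ×-dec (z + toℕ v <? a + l))
    g : ℕ → ℕ → Fin n → ℕ
    g a l v = ind ((a ≤? suc z + toℕ v) ×-dec (suc z + toℕ v <? a + l))
    shift : ∀ v → f (Fin.suc v) ≡ g a l v
    shift v rewrite +-suc z (toℕ v) = refl
    inside : ∀ l → a ≤ z → z < a + l → suc (∑ (allFin n) (g a l)) ≤ l
    inside zero    a≤z z<a = contradiction (≤-trans z<a (≤-reflexive (+-identityʳ a))) (≤⇒≯ a≤z)
    inside (suc l) a≤z _   = s≤s (≤-trans (∑-mono (allFin n) λ v →
      ind-mono ((a ≤? suc z + toℕ v) ×-dec (suc z + toℕ v <? a + suc l))
               ((suc z ≤? suc z + toℕ v) ×-dec (suc z + toℕ v <? suc z + l)) λ (_ , h) →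
        m≤m+n (suc z) _ , ≤-trans h (≤-trans (≤-reflexive (+-suc a l)) (s≤s (+-monoˡ-≤ l a≤z))))
      (interval-size n (suc z) (suc z) l))
    first : (p : Dec (a ≤ z + 0)) (q : Dec (z + 0 < a + l)) →
      ind (p ×-dec q) + ∑ (allFin n) (g a l) ≤ l
    first (no _)  q       = interval-size n (suc z) a l
    first (yes _) (no _)  = interval-size n (suc z) a l
    first (yes p) (yes q) =
      inside l (subst (a ≤_) (+-identityʳ z) p) (subst (_< a + l) (+-identityʳ z) q)

  -- Triples of entries of a random tuple

  module _ {A : Set} where

    ∑² : List A → (A → A → ℕ) → ℕ
    ∑² S g = ∑ S λ a → ∑ S (g a)

    ∑³ : List A → (A → A → A → ℕ) → ℕ
    ∑³ S f = ∑ S λ a → ∑² S (f a)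

    ∑²-∷ : ∀ x S (g : A → A → ℕ) → (∀ a → g a a ≡ 0) →
      ∑² (x ∷ S) g ≡ ∑ S (g x) + ∑ S (λ a → g a x) + ∑² S g
    ∑²-∷ x S g g0 rewrite g0 x | ∑-+ S (λ a → g a x) (λ a → ∑ S (g a)) =
      ≡.sym (+-assoc (∑ S (g x)) _ _)

    -- Terms with the head `x` at two positions vanish, so it stands at exactly one position or at
    -- none.
    ∑³-∷ : ∀ x S (f : A → A → A → ℕ) →
      (∀ a b → f a a b ≡ 0) → (∀ a b → f a b a ≡ 0) → (∀ a b → f a b b ≡ 0) →
      ∑³ (x ∷ S) f ≡
        ∑² S (f x) + ∑² S (λ a c → f a x c) + ∑² S (λ a b → f a b x) + ∑³ S f
    ∑³-∷ x S f h₁₂ h₁₃ h₂₃ = begin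
      ∑² (x ∷ S) (f x) + ∑ S (λ a → ∑² (x ∷ S) (f a))
        ≡⟨ cong₂ _+_ (trans (∑²-∷ x S (f x) (h₂₃ x))
                            (cong₂ (λ a b → a + b + ∑² S (f x)) (∑-zero S (h₁₂ x)) (∑-zero S (h₁₃ x))))
                     (∑-cong S λ a → ∑²-∷ x S (f a) (h₂₃ a)) ⟩
      ∑² S (f x) + ∑ S (λ a → ∑ S (f a x) + ∑ S (λ b → f a b x) + ∑² S (f a))
        ≡⟨ cong (∑² S (f x) +_) (trans (∑-+ S (λ a → ∑ S (f a x) + ∑ S (λ b → f a b x)) (λ a → ∑² S (f a)))
                (cong (_+ ∑³ S f) (∑-+ S (λ a → ∑ S (f a x)) (λ a → ∑ S (λ b → f a b x))))) ⟩
      ∑² S (f x) + (∑² S (λ a c → f a x c) + ∑² S (λ a b → f a b x) + ∑³ S f)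
        ≡⟨ assoc (∑² S (f x)) _ _ _ ⟩
      ∑² S (f x) + ∑² S (λ a c → f a x c) + ∑² S (λ a b → f a b x) + ∑³ S f ∎
      where
      open ≡-Reasoning
      assoc : ∀ p q r s → p + (q + r + s) ≡ p + q + r + s
      assoc = solve-∀

  -- The weights vanish on the diagonals, so only distinct, hence independent, positions contribute.
  module _ (n : ℕ) where

    private
      V = allFin n
      T = tuples n

    -- Linearity of expectation with denominators cleared: each of the `m` entries is uniform.
    ∑-tuples-∑ : ∀ m (h : Fin n → ℕ) →
      n * ∑ (T m) (λ S → ∑ S h) ≡ m * (n ^ m * ∑ V h)
    ∑-tuples-∑ zero    h = *-zeroʳ n
    ∑-tuples-∑ (suc m) h = begin
      n * ∑ (T (suc m)) (λ S → ∑ S h)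
        ≡⟨ cong (n *_) (∑-tuples-suc n m _) ⟩
      n * ∑ V (λ x → ∑ (T m) (λ S → h x + ∑ S h))
        ≡⟨ cong (n *_) (∑-cong V λ x → trans (∑-+ (T m) _ _)
             (cong (_+ X) (∑-tuples-const n m (h x)))) ⟩
      n * ∑ V (λ x → n ^ m * h x + X)
        ≡⟨ cong (n *_) (trans (∑-+ V _ _) (cong₂ _+_ (∑-*ˡ V (n ^ m) h) (∑-ones n X))) ⟩
      n * (n ^ m * ∑ V h + n * X)
        ≡⟨ cong (λ z → n * (n ^ m * ∑ V h + z)) (∑-tuples-∑ m h) ⟩
      n * (n ^ m * ∑ V h + m * (n ^ m * ∑ V h))
        ≡⟨ collect n m (n ^ m) (∑ V h) ⟩
      suc m * (n ^ suc m * ∑ V h) ∎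
      where
      open ≡-Reasoning
      X = ∑ (T m) (λ S → ∑ S h)
      collect : ∀ n m p s → n * (p * s + m * (p * s)) ≡ suc m * ((n * p) * s)
      collect = solve-∀

    ∑-tuples-∑² : ∀ m (g : Fin n → Fin n → ℕ) → (∀ a → g a a ≡ 0) →
      n ^ 2 * ∑ (T m) (λ S → ∑² S g) ≤ m ^ 2 * (n ^ m * ∑² V g)
    ∑-tuples-∑² zero    g g0 = ≤-reflexive (*-zeroʳ (n ^ 2))
    ∑-tuples-∑² (suc m) g g0 = begin
      n ^ 2 * ∑ (T (suc m)) (λ S → ∑² S g)
        ≡⟨ cong (n ^ 2 *_) (trans (∑-tuples-suc n m _)
             (∑-cong V λ x → ∑-cong (T m) λ S → ∑²-∷ x S g g0)) ⟩
      n ^ 2 * ∑ V (λ x → ∑ (T m) (λ S → ∑ S (g x) + ∑ S (λ a → g a x) + ∑² S g))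
        ≡⟨ cong (n ^ 2 *_) (∑-cong V λ x → trans (∑-+ (T m) _ _) (cong (_+ Y) (∑-+ (T m) _ _))) ⟩
      n ^ 2 * ∑ V (λ x → p x + q x + Y)
        ≡⟨ cong (n ^ 2 *_) (trans (∑-+ V _ _) (cong₂ _+_ (∑-+ V p q) (∑-ones n Y))) ⟩
      n ^ 2 * (∑ V p + ∑ V q + n * Y)
        ≡⟨ split n (∑ V p) (∑ V q) Y ⟩
      n * (n * ∑ V p) + n * (n * ∑ V q) + n * (n ^ 2 * Y)
        ≤⟨ +-mono-≤ (≤-reflexive (cong₂ (λ a b → n * a + n * b) P Q))
                    (*-monoʳ-≤ n (∑-tuples-∑² m g g0)) ⟩
      n * (m * (n ^ m * D)) + n * (m * (n ^ m * D)) + n * (m ^ 2 * (n ^ m * D))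
        -- There are only m(m-1) pairs of distinct positions; the added term completes the square of
        -- `suc m`. The cube is completed in the same way for triples.
        ≤⟨ m≤m+n _ (n * (n ^ m * D)) ⟩
      n * (m * (n ^ m * D)) + n * (m * (n ^ m * D)) + n * (m ^ 2 * (n ^ m * D)) + n * (n ^ m * D)
        ≡⟨ collect n m (n ^ m) D ⟩
      suc m ^ 2 * (n ^ suc m * D) ∎
      where
      open ≤-Reasoning
      D = ∑² V g
      Y = ∑ (T m) (λ S → ∑² S g)
      p q : Fin n → ℕ
      p x = ∑ (T m) (λ S → ∑ S (g x))
      q x = ∑ (T m) (λ S → ∑ S (λ a → g a x))
      P : n * ∑ V p ≡ m * (n ^ m * D)
      P = trans (≡.sym (∑-*ˡ V n p)) (trans (∑-cong V λ x → ∑-tuples-∑ m (g x))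
            (trans (∑-*ˡ V m _) (cong (m *_) (∑-*ˡ V (n ^ m) _))))
      Q : n * ∑ V q ≡ m * (n ^ m * D)
      Q = trans (≡.sym (∑-*ˡ V n q)) (trans (∑-cong V λ x → ∑-tuples-∑ m λ a → g a x)
            (trans (∑-*ˡ V m _) (cong (m *_) (trans (∑-*ˡ V (n ^ m) _)
              (cong (n ^ m *_) (∑-swap V V λ x a → g a x))))))
      split : ∀ n p q y → (n * (n * 1)) * (p + q + n * y) ≡ n * (n * p) + n * (n * q) + n * ((n * (n * 1)) * y)
      split = solve-∀
      collect : ∀ n m p d →
        n * (m * (p * d)) + n * (m * (p * d)) + n * ((m * (m * 1)) * (p * d)) + n * (p * d)
        ≡ (suc m * (suc m * 1)) * ((n * p) * d)
      collect = solve-∀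

    ∑-tuples-∑³ : ∀ m (f : Fin n → Fin n → Fin n → ℕ) →
      (∀ a b → f a a b ≡ 0) → (∀ a b → f a b a ≡ 0) → (∀ a b → f a b b ≡ 0) →
      n ^ 3 * ∑ (T m) (λ S → ∑³ S f) ≤ m ^ 3 * (n ^ m * ∑³ V f)
    ∑-tuples-∑³ zero    f h₁₂ h₁₃ h₂₃ = ≤-reflexive (*-zeroʳ (n ^ 3))
    ∑-tuples-∑³ (suc m) f h₁₂ h₁₃ h₂₃ = begin
      n ^ 3 * ∑ (T (suc m)) (λ S → ∑³ S f)
        ≡⟨ cong (n ^ 3 *_) (trans (∑-tuples-suc n m _)
             (∑-cong V λ x → ∑-cong (T m) λ S → ∑³-∷ x S f h₁₂ h₁₃ h₂₃)) ⟩
      n ^ 3 * ∑ V (λ x → ∑ (T m) (λ S → ∑² S (f x) + ∑² S (λ a c → f a x c)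
                                         + ∑² S (λ a b → f a b x) + ∑³ S f))
        ≡⟨ cong (n ^ 3 *_) (∑-cong V λ x → trans (∑-+ (T m) _ _) (cong (_+ Z)
             (trans (∑-+ (T m) _ _) (cong (_+ r x) (∑-+ (T m) _ _))))) ⟩
      n ^ 3 * ∑ V (λ x → p x + q x + r x + Z)
        ≡⟨ cong (n ^ 3 *_) (trans (∑-+ V _ _) (cong₂ _+_
             (trans (∑-+ V _ r) (cong (_+ ∑ V r) (∑-+ V p q))) (∑-ones n Z))) ⟩
      n ^ 3 * (∑ V p + ∑ V q + ∑ V r + n * Z)
        ≡⟨ split n (∑ V p) (∑ V q) (∑ V r) Z ⟩
      n * (n ^ 2 * ∑ V p + n ^ 2 * ∑ V q + n ^ 2 * ∑ V r) + n * (n ^ 3 * Z)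
        ≤⟨ +-mono-≤ (*-monoʳ-≤ n (+-mono-≤ (+-mono-≤ P Q) R))
                    (*-monoʳ-≤ n (∑-tuples-∑³ m f h₁₂ h₁₃ h₂₃)) ⟩
      n * (E + E + E) + n * (m ^ 3 * (n ^ m * D))
        ≤⟨ m≤m+n _ (n * (3 * m * (n ^ m * D) + n ^ m * D)) ⟩
      n * (E + E + E) + n * (m ^ 3 * (n ^ m * D)) + n * (3 * m * (n ^ m * D) + n ^ m * D)
        ≡⟨ collect n m (n ^ m) D ⟩
      suc m ^ 3 * (n ^ suc m * D) ∎
      where
      open ≤-Reasoning
      D = ∑³ V f
      E = m ^ 2 * (n ^ m * D)
      Z = ∑ (T m) (λ S → ∑³ S f)
      slice : (Fin n → Fin n → Fin n → ℕ) → Fin n → ℕ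
      slice f′ x = ∑ (T m) (λ S → ∑² S (f′ x))
      p = slice f
      q = slice (λ x a c → f a x c)
      r = slice (λ x a b → f a b x)
      -- Fixing the new entry at one of the three positions leaves a weight on pairs; exchanging
      -- sums afterwards turns each of the three totals back into `D`.
      slices : ∀ f′ → (∀ x a → f′ x a a ≡ 0) → n ^ 2 * ∑ V (slice f′) ≤ m ^ 2 * (n ^ m * ∑³ V f′)
      slices f′ h = begin
        n ^ 2 * ∑ V (slice f′)                        ≡⟨ ∑-*ˡ V (n ^ 2) _ ⟨
        ∑ V (λ x → n ^ 2 * slice f′ x)                ≤⟨ ∑-mono V (λ x → ∑-tuples-∑² m (f′ x) (h x)) ⟩
        ∑ V (λ x → m ^ 2 * (n ^ m * ∑² V (f′ x)))     ≡⟨ ∑-*ˡ V (m ^ 2) _ ⟩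
        m ^ 2 * ∑ V (λ x → n ^ m * ∑² V (f′ x))       ≡⟨ cong (m ^ 2 *_) (∑-*ˡ V (n ^ m) _) ⟩
        m ^ 2 * (n ^ m * ∑³ V f′)                     ∎
      P : n ^ 2 * ∑ V p ≤ E
      P = slices f h₂₃
      swap₁₂ : ∑³ V (λ x a c → f a x c) ≡ D
      swap₁₂ = ∑-swap V V λ x a → ∑ V (λ c → f a x c)
      Q : n ^ 2 * ∑ V q ≤ E
      Q = subst (λ d → n ^ 2 * ∑ V q ≤ m ^ 2 * (n ^ m * d)) swap₁₂
            (slices (λ x a c → f a x c) λ x a → h₁₃ a x)
      R : n ^ 2 * ∑ V r ≤ E
      R = subst (λ d → n ^ 2 * ∑ V r ≤ m ^ 2 * (n ^ m * d))
            (trans (∑-swap V V λ x a → ∑ V (λ b → f a b x))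
                   (∑-cong V λ a → ∑-swap V V λ x b → f a b x))
            (slices (λ x a b → f a b x) λ x a → h₁₂ a x)
      split : ∀ n p q r z → (n * (n * (n * 1))) * (p + q + r + n * z)
            ≡ n * ((n * (n * 1)) * p + (n * (n * 1)) * q + (n * (n * 1)) * r) + n * ((n * (n * (n * 1))) * z)
      split = solve-∀
      collect : ∀ n m p d →
        n * ((m * (m * 1)) * (p * d) + (m * (m * 1)) * (p * d) + (m * (m * 1)) * (p * d)) + n * ((m * (m * (m * 1))) * (p * d))
          + n * (3 * m * (p * d) + p * d)
        ≡ (suc m * (suc m * (suc m * 1))) * ((n * p) * d)
      collect = solve-∀

  -- Ordered graphs and chains of sampled neighbours

  <ᵛ⇒< : ∀ {n} {u v : Fin n} → (u <ᵛ v) ≡ true → u Fin.< v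
  <ᵛ⇒< {u = u} eq = <ᵇ⇒< (toℕ u) _ (Equivalence.from Bool.T-≡ eq)

  <⇒<ᵛ : ∀ {n} {u v : Fin n} → u Fin.< v → (u <ᵛ v) ≡ true
  <⇒<ᵛ u<v = Equivalence.to Bool.T-≡ (<⇒<ᵇ u<v)

  ≮⇒<ᵛ : ∀ {n} {u v : Fin n} → ¬ u Fin.< v → (u <ᵛ v) ≡ false
  ≮⇒<ᵛ {u = u} {v} u≮v with u <ᵛ v in eq
  ... | false = refl
  ... | true  = contradiction (<ᵛ⇒< {u = u} eq) u≮v

  ∧-true : ∀ {a b} → a ∧ b ≡ true → a ≡ true × b ≡ true
  ∧-true {true} {true} _ = refl , refl

  module _ {n : ℕ} (G : OrdGraph n) where

    infix 4 _⟶_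
    _⟶_ : Fin n → Fin n → Set
    u ⟶ v = u Fin.< v × adj G u v ≡ true

    _⟶?_ : ∀ u v → Dec (u ⟶ v)
    u ⟶? v = (u Fin.<? v) ×-dec (adj G u v Bool.≟ true)

    -- `D`-freeness of the graph spanned by `L`, in the form that forward neighbourhoods are
    -- cliques.
    Clean : List (Fin n) → Set
    Clean L = ∀ {u v w} → u ∈ L → v ∈ L → w ∈ L → u ⟶ v → u ⟶ w → v Fin.< w → v ⟶ w

    D : Fin n → Fin n → Fin n → ℕ
    D u v w = indicator (isD G u v w)

    isD-intro : ∀ {u v w} → u ⟶ v → u ⟶ w → v Fin.< w → ¬ v ⟶ w → isD G u v w ≡ true
    isD-intro {u} {v} {w} (u<v , uv) (_ , uw) v<w ¬vw
      rewrite <⇒<ᵛ {u = u} u<v | <⇒<ᵛ {u = v} v<w | uv | uw with adj G v w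
    ... | false = refl
    ... | true  = contradiction (v<w , refl) ¬vw

    isD-elim : ∀ u v w → isD G u v w ≡ true → u ⟶ v × u ⟶ w × v Fin.< w × adj G v w ≡ false
    isD-elim u v w eq with ∧-true {u <ᵛ v} eq
    ... | u<v , eq₁ with ∧-true {v <ᵛ w} eq₁
    ... | v<w , eq₂ with ∧-true {adj G u v} eq₂
    ... | uv , eq₃ with ∧-true {adj G u w} eq₃
    ... | uw , vw =
      let u<v′ = <ᵛ⇒< {u = u} u<v ; v<w′ = <ᵛ⇒< {u = v} v<w in
      (u<v′ , uv) , (<-trans u<v′ v<w′ , uw) , v<w′ , Equivalence.to Bool.T-not-≡ (Equivalence.from Bool.T-≡ vw)

    D-zero : ∀ {u v w} → ¬ (u Fin.< v × v Fin.< w) → D u v w ≡ 0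
    D-zero {u} {v} {w} h with isD G u v w in eq
    ... | false = refl
    ... | true with isD-elim u v w eq
    ... | (u<v , _) , _ , v<w , _ = contradiction (u<v , v<w) h

    clean : ∀ L → ∑³ L D ≡ 0 → Clean L
    clean L none {u} {v} {w} u∈ v∈ w∈ uv uw v<w with v ⟶? w
    ... | yes vw = vw
    ... | no ¬vw = contradiction
      (≤-trans (≤-reflexive (cong indicator (≡.sym (isD-intro uv uw v<w ¬vw))))
        (≤-trans (term≤∑ L (D u v) w∈)
        (≤-trans (term≤∑ L (λ y → ∑ L (D u y)) v∈)
        (≤-trans (term≤∑ L (λ x → ∑² L (D x)) u∈) (≤-reflexive none))))) λ ()

  module _ {n : ℕ} {R : Fin n → Fin n → Set} (R? : ∀ u v → Dec (R u v)) where

    fromUpper : OrdGraph n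
    fromUpper .adj i j = (i <ᵛ j) ∧ does (R? i j) ∨ (j <ᵛ i) ∧ does (R? j i)
    fromUpper .sym i j = Bool.∨-comm ((i <ᵛ j) ∧ does (R? i j)) _
    fromUpper .irrefl i rewrite ≮⇒<ᵛ {u = i} {i} (<-irrefl refl) = refl

    adj-fromUpper : ∀ u v → u Fin.< v → adj fromUpper u v ≡ does (R? u v)
    adj-fromUpper u v u<v rewrite <⇒<ᵛ {u = u} u<v | ≮⇒<ᵛ {u = v} {u} (<-asym u<v) = Bool.∨-identityʳ _

    adj⇒ : ∀ u v → u Fin.< v → adj fromUpper u v ≡ true → R u v
    adj⇒ u v u<v eq with R? u v | adj-fromUpper u v u<v
    ... | yes r | _   = r
    ... | no _  | eq′ = contradiction (trans (≡.sym eq) eq′) λ ()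

    ⇒adj : ∀ u v → u Fin.< v → R u v → adj fromUpper u v ≡ true
    ⇒adj u v u<v r = trans (adj-fromUpper u v u<v) (dec-true (R? u v) r)

    fromUpper-DFree : (∀ {u v w} → u Fin.< v → v Fin.< w → R u v → R u w → R v w) →
                      InducedDFree fromUpper
    fromUpper-DFree closed u v w with isD fromUpper u v w in eq
    ... | false = refl
    ... | true with isD-elim fromUpper u v w eq
    ... | (u<v , uv) , (u<w , uw) , v<w , ¬vw = contradiction
      (trans (≡.sym (⇒adj v w v<w (closed u<v v<w (adj⇒ u v u<v uv) (adj⇒ u w u<w uw)))) ¬vw) λ ()

  module Chain {n : ℕ} (G : OrdGraph n) (b : Fin n → ℕ) (b-mono : ∀ {u v} → u Fin.≤ v → b u ≤ b v)
               (S : List (Fin n)) where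

    open DecMembership (Fin._≟_ {n}) using (_∈?_)

    private
      infix 4 _⇒_
      _⇒_ = _⟶_ G

    b-cancel-< : ∀ {u v} → b u < b v → u Fin.< v
    b-cancel-< bu<bv = ≰⇒> λ v≤u → <⇒≱ bu<bv (b-mono v≤u)

    Next : Fin n → Fin n → Set
    Next u = Least (λ y → u ⇒ y × y ∈ S)

    -- The chain of u repeatedly passes to the first sampled forward neighbour;
    -- Exit j u r says that r is its first vertex after u in a block beyond j.
    data Exit (j : ℕ) : Fin n → Maybe (Fin n) → Set where
      none : ∀ {u} → (∀ y → ¬ (u ⇒ y × y ∈ S)) → Exit j u nothing
      out  : ∀ {u y} → Next u y → j < b y → Exit j u (just y)
      pass : ∀ {u y r} → Next u y → b y ≤ j → Exit j y r → Exit j u r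

    next-unique : ∀ {u y z} → Next u y → Next u z → y ≡ z
    next-unique (py , ly) (pz , lz) = Fin.≤-antisym (ly _ pz) (lz _ py)

    exit-unique : ∀ {j u r s} → Exit j u r → Exit j u s → r ≡ s
    exit-unique (none h)      (none _)             = refl
    exit-unique (none h)      (out (p , _) _)      = contradiction p (h _)
    exit-unique (none h)      (pass (p , _) _ _)   = contradiction p (h _)
    exit-unique (out (p , _) _) (none h)           = contradiction p (h _)
    exit-unique (out p _)     (out q _)            = cong just (next-unique p q)
    exit-unique (out p j<b)   (pass q b≤j _)
      rewrite next-unique p q                      = contradiction j<b (≤⇒≯ b≤j)
    exit-unique (pass (p , _) _ _) (none h)        = contradiction p (h _)
    exit-unique (pass p b≤j _) (out q j<b)
      rewrite next-unique p q                      = contradiction j<b (≤⇒≯ b≤j)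
    exit-unique (pass p _ d)  (pass q _ e)
      rewrite next-unique p q                      = exit-unique d e

    private
      exit-total : ∀ j u → Acc Fin._>_ u → ∃ (Exit j u)
      exit-total j u (acc rs) with least? (λ y → (_⟶?_ G u y) ×-dec (y ∈? S))
      ... | inj₂ h = nothing , none h
      ... | inj₁ (y , p@(((u<y , _) , _) , _)) with j <? b y
      ... | yes j<b = just y , out p j<b
      ... | no j≮b with exit-total j y (rs u<y)
      ... | r , d = r , pass p (≮⇒≥ j≮b) d

    -- The well-founded recursion is never unfolded later: arguments go by induction on `Exit`
    -- derivations and return to `exit` through `exit-unique`.
    exit : ℕ → Fin n → Maybe (Fin n)
    exit j u = proj₁ (exit-total j u (>-wellFounded u))

    exits : ∀ j u → Exit j u (exit j u)
    exits j u = proj₂ (exit-total j u (>-wellFounded u))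

    exit-≡ : ∀ {j u r} → Exit j u r → exit j u ≡ r
    exit-≡ = exit-unique (exits _ _)

    exit-just : ∀ {j u y} → Exit j u (just y) → u Fin.< y × y ∈ S × j < b y
    exit-just (out (((u<y , _) , y∈) , _) j<b) = u<y , y∈ , j<b
    exit-just (pass (((u<y , _) , _) , _) _ d) =
      let y<z , z∈ , j<b = exit-just d in <-trans u<y y<z , z∈ , j<b

    -- After its exit `y` from an earlier block, the chain of `u` is the chain of `y`. Hence a later
    -- exit is a function of the earlier one, namely this one, and equality of exits is inherited by
    -- later blocks.
    resume : ℕ → Maybe (Fin n) → Maybe (Fin n)
    resume j nothing = nothing
    resume j (just y) with j <? b y
    ... | yes _ = just y
    ... | no _  = exit j y

    exit-resume : ∀ {i j u r} → i ≤ j → Exit i u r → exit j u ≡ resume j r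
    exit-resume i≤j (none h) = exit-≡ (none h)
    exit-resume {j = j} i≤j (out {y = y} p _) with j <? b y
    ... | yes j<b = exit-≡ (out p j<b)
    ... | no j≮b  = exit-≡ (pass p (≮⇒≥ j≮b) (exits j y))
    exit-resume {j = j} i≤j (pass {y = y} p b≤i d) =
      trans (exit-≡ (pass p (≤-trans b≤i i≤j) (exits j y))) (exit-resume i≤j d)

    exit-merged : ∀ {i j u v} → i ≤ j → exit i u ≡ exit i v → exit j u ≡ exit j v
    exit-merged {i} {j} {u} {v} i≤j eq = trans (exit-resume i≤j (exits i u))
      (trans (cong (resume j) eq) (≡.sym (exit-resume i≤j (exits i v))))

    module _ {L : List (Fin n)} (cl : Clean G L) (S⊆L : ∀ {x} → x ∈ S → x ∈ L) where

      -- The chain of `u` runs through `x`: the first sampled neighbour `y` of `u` is `x` or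
      -- precedes it, and in the latter case cleanness gives `y ⇒ x`, so the argument repeats from
      -- `y`.
      exit-through : ∀ {j u x r} → u ∈ L → u ⇒ x → x ∈ S → b x ≤ j → Exit j u r → Exit j x r
      exit-through u∈ ux x∈ b≤j (none h) = contradiction (ux , x∈) (h _)
      exit-through u∈ ux x∈ b≤j (out (_ , least) j<b) =
        contradiction j<b (≤⇒≯ (≤-trans (b-mono (least _ (ux , x∈))) b≤j))
      exit-through {x = x} u∈ ux x∈ b≤j (pass {y = y} ((uy , y∈) , least) _ d) with y Fin.≟ x
      ... | yes refl = d
      ... | no y≢x   = exit-through (S⊆L y∈) yx x∈ b≤j d
        where
        yx = cl u∈ (S⊆L y∈) (S⊆L x∈) uy ux (Fin.≤∧≢⇒< (least _ (ux , x∈)) y≢x)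

      -- Cleanness hands the forward edge to `v` from each chain vertex to the next, as long as the
      -- chain stays before `v`.
      exit-adj : ∀ {j u v y} → u ∈ L → v ∈ L → u ⇒ v → Exit j u (just y) → y Fin.< v → y ⇒ v
      exit-adj u∈ v∈ uv (out ((uy , y∈) , _) _) y<v = cl u∈ (S⊆L y∈) v∈ uy uv y<v
      exit-adj u∈ v∈ uv (pass ((uy , y∈) , _) _ d) z<v = exit-adj (S⊆L y∈) v∈
        (cl u∈ (S⊆L y∈) v∈ uy uv (<-trans (proj₁ (exit-just d)) z<v)) d z<v

      -- Chain vertices up to block `j` precede `x` and remain adjacent to it, so the chain can
      -- neither end nor jump over `x` before leaving block `j`.
      exit-before : ∀ {j u x r} → u ∈ L → u ⇒ x → x ∈ S → j < b x → Exit j u r →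
                    ∃ λ y → r ≡ just y × y Fin.≤ x
      exit-before u∈ ux x∈ j<b (none h) = contradiction (ux , x∈) (h _)
      exit-before u∈ ux x∈ j<b (out (_ , least) _) = _ , refl , least _ (ux , x∈)
      exit-before u∈ ux x∈ j<b (pass ((uy , y∈) , least) b≤j d) =
        exit-before (S⊆L y∈) (cl u∈ (S⊆L y∈) (S⊆L x∈) uy ux (b-cancel-< (≤-<-trans b≤j j<b))) x∈ j<b d

    -- The first clause is inherited along growing blocks. The second keeps the added edges few: it
    -- supplies the edge from `y` to `v` in `spurious-blocks`. Its exits are tested from the block
    -- of `u` on, a range that only shrinks when `u` is replaced by a later vertex.
    Merged : Fin n → Fin n → Set
    Merged u v = exit (b v) u ≡ exit (b v) v ×
      (∀ {j} → j < b v → b u ≤ j → ∀ y → exit j u ≡ just y → b y < b v → adj G y v ≡ true)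

    merged? : ∀ u v → Dec (Merged u v)
    merged? u v = ≡-dec Fin._≟_ (exit (b v) u) (exit (b v) v) ×-dec
      allUpTo? (λ j → (b u ≤? j) →-dec Fin.all? λ y →
        ≡-dec Fin._≟_ (exit j u) (just y) →-dec (b y <? b v) →-dec (adj G y v Bool.≟ true)) (b v)

    -- From the block of `v` on, `u` and `v` have the same exits, so both clauses of `Merged u w`
    -- can be read with `v` in place of `u`.
    merged-trans : ∀ {u v w} → u Fin.< v → v Fin.< w → Merged u v → Merged u w → Merged v w
    merged-trans {u} {v} {w} u<v v<w (uv , _) (uw , adj-w) =
      trans (≡.sym (exit-merged (b-mono (<⇒≤ v<w)) uv)) uw ,
      λ j<b b≤j y eq → adj-w j<b (≤-trans (b-mono (<⇒≤ u<v)) b≤j) y (trans (exit-merged b≤j uv) eq)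

    module Approx (S₀ : List (Fin n)) where

      Covered : Fin n → Set
      Covered v = Any (_⇒ v) S₀

      -- Vertices without a sampled backward neighbour have few backward edges, which are deleted;
      -- their forward neighbourhoods may then be arbitrary subsets of cliques.
      Approx : Fin n → Fin n → Set
      Approx u v = Covered v × Merged u v × (Covered u ⊎ adj G u v ≡ true)

      approx? : ∀ u v → Dec (Approx u v)
      approx? u v = any? (λ t → _⟶?_ G t v) S₀ ×-dec merged? u v ×-dec
        (any? (λ t → _⟶?_ G t u) S₀ ⊎-dec (adj G u v Bool.≟ true))

      H : OrdGraph n
      H = fromUpper approx?

      H-DFree : InducedDFree H
      H-DFree = fromUpper-DFree approx? λ { u<v v<w (cv , mv , _) (cw , mw , _) →
        -- As the upper end of an edge, `v` is covered, which settles the last clause for the pair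
        -- `v`, `w`.
        cw , merged-trans u<v v<w mv mw , inj₁ cv }

  -- Comparison with the approximating graph

  indicator-≤ : ∀ {c m} → (c ≡ true → 0 < m) → indicator c ≤ m
  indicator-≤ {false} h = z≤n
  indicator-≤ {true}  h = h refl

  ind-pos : {P : Set} (P? : Dec P) → P → 0 < ind P?
  ind-pos P? p = ≤-reflexive (≡.sym (ind-yes P? p))

  posˡ : ∀ {a} c → 0 < a → 0 < a + c
  posˡ c h = ≤-trans h (m≤m+n _ c)

  posʳ : ∀ a {c} → 0 < c → 0 < a + c
  posʳ a h = ≤-trans h (m≤n+m _ a)

  missed-or-hit : ∀ {n} {A : Fin n → Set} (A? : Decidable A) {v} → A v → ∀ S →
                  Missed A? S v ⊎ Any (Beyond A? v) S
  missed-or-hit A? {v} a S with any? (beyond? A? v) S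
  ... | yes h = inj₂ h
  ... | no ¬h = inj₁ (a , ¬Any⇒All¬ S ¬h)

  module Errors {n : ℕ} (G : OrdGraph n) (b : Fin n → ℕ) (b-mono : ∀ {u v} → u Fin.≤ v → b u ≤ b v)
                (S S₀ : List (Fin n)) where

    open Chain G b b-mono S
    open Approx S₀

    private
      V = allFin n
      infix 4 _⇒_ _⇒?_
      _⇒_ = _⟶_ G
      _⇒?_ = _⟶?_ G

    inBlock? : ∀ u j → Decidable (λ x → u ⇒ x × b x ≡ j)
    inBlock? u j x = (u ⇒? x) ×-dec (b x ≟ j)

    sample : Fin n → Fin n → List (Fin n)
    sample u v = u ∷ v ∷ S₀ ++ S

    S⊆ : ∀ {u v x} → x ∈ S → x ∈ sample u v
    S⊆ x∈ = there (there (∈-++⁺ʳ S₀ x∈))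

    S₀⊆ : ∀ {u v t} → t ∈ S₀ → t ∈ sample u v
    S₀⊆ t∈ = there (there (∈-++⁺ˡ t∈))

    -- Either `v` is `x` itself, a vertex on the chain of `u`, or cleanness gives `v ⇒ x` and both
    -- chains run through `x`.
    exit-same : ∀ {L j u v x} → Clean G L → (∀ {y} → y ∈ S → y ∈ L) → u ∈ L → v ∈ L →
      u ⇒ v → u ⇒ x → x ∈ S → b x ≤ j → v Fin.≤ x → exit j u ≡ exit j v
    exit-same {j = j} {u} {v} {x} cl S⊆L u∈ v∈ uv ux x∈ b≤j v≤x with v Fin.≟ x
    ... | yes refl = exit-unique (exit-through cl S⊆L u∈ ux x∈ b≤j (exits j u)) (exits j v)
    ... | no v≢x   = exit-unique (exit-through cl S⊆L u∈ ux x∈ b≤j (exits j u))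
      (exit-through cl S⊆L v∈ (cl u∈ v∈ (S⊆L x∈) uv ux (Fin.≤∧≢⇒< v≤x v≢x)) x∈ b≤j (exits j v))

    -- A sampled neighbour of `u` at or after `v` in the block of `v` makes the two chains meet
    -- before they leave that block; the second clause of `Merged` is `exit-adj`.
    merged : ∀ {L u v} → Clean G L → (∀ {y} → y ∈ S → y ∈ L) → u ∈ L → v ∈ L → u ⇒ v →
      Any (Beyond (inBlock? u (b v)) v) S → Merged u v
    merged {u = u} cl S⊆L u∈ v∈ uv hit with find hit
    ... | x , x∈ , (ux , bx) , v≤x =
      exit-same cl S⊆L u∈ v∈ uv ux x∈ (≤-reflexive bx) v≤x ,
      λ {j} j<b _ y eq by<bv → proj₂ (exit-adj cl S⊆L u∈ v∈ uv
        (subst (Exit j u) eq (exits j u)) (b-cancel-< by<bv))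

    -- A non-edge of `G` that may be added, with `t` as the vertex covering `u`. The argument `u`
    -- comes last because `t` and `v` are fixed when these are counted.
    Spurious : Fin n → Fin n → Fin n → Set
    Spurious t v u = ∑³ (sample u v) (D G) ≡ 0 × t ⇒ u × b u < b v × adj G u v ≡ false ×
                     Merged u v × Any (Beyond (inBlock? t (b u)) u) S

    spurious? : ∀ t v u → Dec (Spurious t v u)
    spurious? t v u = (∑³ (sample u v) (D G) ≟ 0) ×-dec (t ⇒? u) ×-dec (b u <? b v) ×-dec
      (adj G u v Bool.≟ false) ×-dec merged? u v ×-dec any? (beyond? (inBlock? t (b u)) u) S

    forwardMiss backwardMiss : Fin n → Fin n → ℕ
    forwardMiss u v = ind (missed? (inBlock? u (b v)) S v)
    backwardMiss u v = ind (missed? (_⇒? v) S₀ u)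

    -- A differing pair is charged to a copy of `D` in its sample, or to a common block. Otherwise a
    -- lost edge is charged to a miss of `v` by `S` or of `u` by `S₀`, and an added edge to the
    -- vertex `t` covering `u`: either `S` misses `u` in the neighbourhood of `t`, or the pair is
    -- spurious.
    error≤ : ∀ u v → indicator ((u <ᵛ v) ∧ (adj G u v xor adj H u v)) ≤
      ∑³ (sample u v) (D G) + (ind (b u ≟ b v) + (forwardMiss u v + (backwardMiss u v
        + (∑ S₀ (λ t → forwardMiss t u) + ∑ S₀ (λ t → ind (spurious? t v u))))))
    error≤ u v = indicator-≤ λ eq →
      let u<v , diff = ∧-true eq in cases (<ᵛ⇒< {u = u} u<v) diff
      where
      K = ∑³ (sample u v) (D G)
      B = ind (b u ≟ b v)
      M₁ = forwardMiss u v
      M₂ = backwardMiss u v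
      M₃ = ∑ S₀ (λ t → forwardMiss t u)
      cases : u Fin.< v → adj G u v xor adj H u v ≡ true →
        0 < K + (B + (M₁ + (M₂ + (M₃ + ∑ S₀ (λ t → ind (spurious? t v u))))))
      cases u<v diff with toSum (K ≟ 0) | toSum (b u ≟ b v)
      ... | inj₂ K≢0 | _            = posˡ _ (n≢0⇒n>0 K≢0)
      ... | inj₁ _   | inj₁ bu≡bv   = posʳ K (posˡ _ (ind-pos (b u ≟ b v) bu≡bv))
      ... | inj₁ K≡0 | inj₂ bu≢bv = posʳ K (posʳ B (go (adj G u v) refl diff))
        where
        bu<bv : b u < b v
        bu<bv = ≤∧≢⇒< (b-mono (<⇒≤ u<v)) bu≢bv
        cl = clean G (sample u v) K≡0
        go : ∀ c → adj G u v ≡ c → c xor adj H u v ≡ true →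
          0 < M₁ + (M₂ + (M₃ + ∑ S₀ (λ t → ind (spurious? t v u))))
        go true uv diff with missed-or-hit (inBlock? u (b v)) ((u<v , uv) , refl) S
        ... | inj₁ miss = posˡ _ (ind-pos (missed? (inBlock? u (b v)) S v) miss)
        ... | inj₂ hit with toSum (any? (_⇒? v) S₀)
        -- An uncovered `v` has no backward neighbour in `S₀` at all, in particular none at or after
        -- `u`.
        ... | inj₂ ¬cov = posʳ M₁ (posˡ _ (ind-pos (missed? (_⇒? v) S₀ u)
          ((u<v , uv) , ¬Any⇒All¬ S₀ λ h → let t , t∈ , tv , _ = find h in ¬cov (lose t∈ tv))))
        ... | inj₁ cov = contradiction
          (trans (≡.sym (⇒adj approx? u v u<v
            (cov , merged cl S⊆ (here refl) (there (here refl)) (u<v , uv) hit , inj₂ uv)))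
            (Bool.not-injective {adj H u v} {false} diff)) λ ()
        go false ¬uv diff with adj⇒ approx? u v u<v diff
        ... | _ , _ , inj₂ uv = contradiction (trans (≡.sym uv) ¬uv) λ ()
        ... | _ , mer , inj₁ cov with find cov
        ... | t , t∈ , tu with missed-or-hit (inBlock? t (b u)) (tu , refl) S
        ... | inj₁ miss = posʳ M₁ (posʳ M₂ (posˡ _
          (≤-trans (ind-pos (missed? (inBlock? t (b u)) S u) miss) (term≤∑ S₀ _ t∈))))
        ... | inj₂ hit = posʳ M₁ (posʳ M₂ (posʳ M₃
          (≤-trans (ind-pos (spurious? t v u) (K≡0 , tu , bu<bv , ¬uv , mer , hit)) (term≤∑ S₀ _ t∈))))

    -- Once the chain of t has met a vertex y adjacent to v, every later vertex adjacent to t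
    -- and beyond y is adjacent to both y and v's clique, hence not spurious.
    spurious-blocks : ∀ {t v u u′} → t ∈ S₀ → u Fin.≤ u′ → Spurious t v u → Spurious t v u′ →
      b u′ ≡ b u ⊎ b u′ ≡ maybe b 0 (exit (b u) t)
    spurious-blocks {t} {v} {u} {u′} t∈ u≤u′ (c , tu , bu<bv , _ , (_ , adj-v) , hit)
                    (c′ , tu′ , bu′<bv , ¬u′v , _ , hit′) with b u′ ≟ b u
    ... | yes eq = inj₁ eq
    ... | no neq with find hit | find hit′
    ... | x , x∈ , (tx , bx) , u≤x | x′ , x′∈ , (tx′ , bx′) , _
      -- The vertex `x′` shares the block of `u′`, which is later than that of `u`; hence the chain
      -- of `t` has an exit `y`, at or before `x′`.
      with exit-before (clean G (sample u v) c) S⊆ (S₀⊆ t∈) tx′ x′∈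
             (subst (b u <_) (≡.sym bx′) (≤∧≢⇒< (b-mono u≤u′) (neq ∘ ≡.sym))) (exits (b u) t)
    ... | y , eq , y≤x′ rewrite eq = inj₂ (≤-antisym (b-mono (≮⇒≥ y≮u′)) by≤)
      where
      cl′ = clean G (sample u′ v) c′
      by≤ : b y ≤ b u′
      by≤ = ≤-trans (b-mono y≤x′) (≤-reflexive bx′)
      by<bv = ≤-<-trans by≤ bu′<bv
      ty : Exit (b u) t (just y)
      ty = subst (Exit (b u) t) eq (exits (b u) t)
      -- The hit `x` makes the chains of `t` and `u` meet within the block of `u`, so `y` is the
      -- exit of `u` as well and `Merged u v` makes it adjacent to `v`.
      uy : exit (b u) u ≡ just y
      uy = trans (≡.sym (exit-same (clean G (sample u v) c) S⊆ (S₀⊆ t∈) (here refl) tu tx x∈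
             (≤-reflexive bx) u≤x)) eq
      yv : y ⇒ v
      yv = b-cancel-< by<bv , adj-v bu<bv ≤-refl y uy by<bv
      -- If `y` came before `u′`, it would be adjacent to both `u′` and `v`, and cleanness would
      -- force the missing edge. So `u′` ≤ `y` ≤ `x′`, and `y` lies in the block of `u′`.
      y≮u′ : ¬ y Fin.< u′
      y≮u′ y<u′ = contradiction (trans (≡.sym ¬u′v) (proj₂ u′v)) λ ()
        where
        u′v : u′ ⇒ v
        u′v = cl′ (S⊆ (proj₁ (proj₂ (exit-just ty)))) (here refl) (there (here refl))
          (exit-adj cl′ S⊆ (S₀⊆ t∈) (here refl) tu′ ty y<u′) yv (b-cancel-< bu′<bv)

    module _ (l : ℕ) (block≤ : ∀ j → ∑ V (λ v → ind (b v ≟ j)) ≤ l) where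

      -- Comparison with the least spurious `u` confines all others to its own block and the block
      -- of the exit of `t`.
      ∑-spurious : ∀ {t} → t ∈ S₀ → ∀ v → ∑ V (λ u → ind (spurious? t v u)) ≤ l + l
      ∑-spurious {t} t∈ v with least? (spurious? t v)
      ... | inj₂ ¬sp = ≤-trans (≤-reflexive (∑-zero V λ u → ind-no (spurious? t v u) (¬sp u))) z≤n
      ... | inj₁ (u , sp , least) = begin
        ∑ V (λ u′ → ind (spurious? t v u′))
          ≤⟨ ∑-mono V two ⟩
        ∑ V (λ u′ → ind (b u′ ≟ b u) + ind (b u′ ≟ c))
          ≡⟨ ∑-+ V _ _ ⟩
        ∑ V (λ u′ → ind (b u′ ≟ b u)) + ∑ V (λ u′ → ind (b u′ ≟ c))
          ≤⟨ +-mono-≤ (block≤ (b u)) (block≤ c) ⟩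
        l + l ∎
        where
        open ≤-Reasoning
        -- The default 0 is arbitrary: if the chain of `t` has no exit, `spurious-blocks` places
        -- every spurious vertex in the block of `u` or in block 0, and the bound holds either way.
        c = maybe b 0 (exit (b u) t)
        two : ∀ u′ → ind (spurious? t v u′) ≤ ind (b u′ ≟ b u) + ind (b u′ ≟ c)
        two u′ = indicator-≤ λ eq → positive (spurious? t v u′) eq
          where
          positive : (d : Dec (Spurious t v u′)) → does d ≡ true → 0 < ind (b u′ ≟ b u) + ind (b u′ ≟ c)
          positive (yes sp′) _ with spurious-blocks t∈ (least u′ sp′) sp sp′
          ... | inj₁ e = posˡ _ (ind-pos (b u′ ≟ b u) e)
          ... | inj₂ e = posʳ (ind (b u′ ≟ b u)) (ind-pos (b u′ ≟ c) e)

      -- The six charges of `error≤` summed over all pairs, with pairs inside a block and spurious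
      -- pairs already replaced by bounds in terms of `l`.
      cost : ℕ
      cost = ∑ V (λ u → ∑ V (λ v → ∑³ (sample u v) (D G)))
           + (n * l
           + (∑ V (λ u → ∑ V (forwardMiss u))
           + (∑ V (λ v → ∑ V (λ u → backwardMiss u v))
           + (n * ∑ S₀ (λ t → ∑ V (forwardMiss t))
           + length S₀ * (n * (l + l))))))

      dist≤cost : dist G H ≤ cost
      dist≤cost = begin
        dist G H
          ≤⟨ ∑-mono V (λ u → ∑-mono V (error≤ u)) ⟩
        ∑ V (λ u → ∑ V (λ v → K u v + (B u v + (M₁ u v + (M₂ u v + (M₃ u v + X u v))))))
          ≡⟨ split K _ ⟩
        ΣΣ K + ΣΣ (λ u v → B u v + (M₁ u v + (M₂ u v + (M₃ u v + X u v))))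
          ≡⟨ cong (ΣΣ K +_) (split B _) ⟩
        ΣΣ K + (ΣΣ B + ΣΣ (λ u v → M₁ u v + (M₂ u v + (M₃ u v + X u v))))
          ≡⟨ cong (λ z → ΣΣ K + (ΣΣ B + z)) (trans (split M₁ _) (cong (ΣΣ M₁ +_)
               (trans (split M₂ _) (cong (ΣΣ M₂ +_) (split M₃ X))))) ⟩
        ΣΣ K + (ΣΣ B + (ΣΣ M₁ + (ΣΣ M₂ + (ΣΣ M₃ + ΣΣ X))))
          ≤⟨ +-monoʳ-≤ (ΣΣ K) (+-mono-≤ blocks (+-monoʳ-≤ (ΣΣ M₁)
               (+-mono-≤ (≤-reflexive (∑-swap V V M₂)) (+-mono-≤ (≤-reflexive covers) spurious)))) ⟩
        cost ∎
        where
        open ≤-Reasoning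
        ΣΣ : (Fin n → Fin n → ℕ) → ℕ
        ΣΣ f = ∑ V (λ u → ∑ V (f u))
        K B M₁ M₂ M₃ X : Fin n → Fin n → ℕ
        K u v = ∑³ (sample u v) (D G)
        B u v = ind (b u ≟ b v)
        M₁ = forwardMiss
        M₂ = backwardMiss
        M₃ u v = ∑ S₀ (λ t → forwardMiss t u)
        X u v = ∑ S₀ (λ t → ind (spurious? t v u))
        split : ∀ f g → ΣΣ (λ u v → f u v + g u v) ≡ ΣΣ f + ΣΣ g
        split f g = trans (∑-cong V λ u → ∑-+ V (f u) (g u)) (∑-+ V _ _)
        blocks : ΣΣ B ≤ n * l
        blocks = begin
          ΣΣ B               ≡⟨ ∑-swap V V B ⟩
          ∑ V (λ v → ∑ V (λ u → B u v)) ≤⟨ ∑-mono V (λ v → block≤ (b v)) ⟩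
          ∑ V (λ _ → l)      ≡⟨ ∑-ones n l ⟩
          n * l              ∎
        covers : ΣΣ M₃ ≡ n * ∑ S₀ (λ t → ∑ V (forwardMiss t))
        covers = begin-equality
          ΣΣ M₃                                       ≡⟨ ∑-cong V (λ u → ∑-ones n (M₃ u u)) ⟩
          ∑ V (λ u → n * M₃ u u)                      ≡⟨ ∑-*ˡ V n _ ⟩
          n * ∑ V (λ u → ∑ S₀ (λ t → forwardMiss t u)) ≡⟨ cong (n *_) (∑-swap V S₀ λ u t → forwardMiss t u) ⟩
          n * ∑ S₀ (λ t → ∑ V (forwardMiss t))        ∎
        spurious : ΣΣ X ≤ length S₀ * (n * (l + l))
        spurious = begin
          ΣΣ X
            ≡⟨ ∑-swap V V X ⟩
          ∑ V (λ v → ∑ V (λ u → X u v))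
            ≡⟨ ∑-cong V (λ v → ∑-swap V S₀ λ u t → ind (spurious? t v u)) ⟩
          ∑ V (λ v → ∑ S₀ (λ t → ∑ V (λ u → ind (spurious? t v u))))
            ≡⟨ ∑-swap V S₀ _ ⟩
          ∑ S₀ (λ t → ∑ V (λ v → ∑ V (λ u → ind (spurious? t v u))))
            ≤⟨ ∑-mono-∈ S₀ (λ t t∈ → ∑-mono V (∑-spurious t∈)) ⟩
          ∑ S₀ (λ _ → ∑ V (λ _ → l + l))
            ≡⟨ trans (∑-const S₀ _) (cong (length S₀ *_) (∑-ones n (l + l))) ⟩
          length S₀ * (n * (l + l)) ∎

  -- Averaging over the samples

  module Average {n : ℕ} (G : OrdGraph n) (b : Fin n → ℕ) (b-mono : ∀ {u v} → u Fin.≤ v → b u ≤ b v)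
                 (k : ℕ) (b<k : ∀ v → b v < k)
                 (l : ℕ) (block≤ : ∀ j → ∑ (allFin n) (λ v → ind (b v ≟ j)) ≤ l)
                 (m₀ m : ℕ) where

    private
      V = allFin n
      T₀ = tuples n m₀
      T₁ = tuples n m
      module E S₀ S = Errors G b b-mono S S₀

      ΣΣ : (List (Fin n) → List (Fin n) → ℕ) → ℕ
      ΣΣ f = ∑ T₀ λ S₀ → ∑ T₁ (f S₀)

      ΣΣ-+ : ∀ f g → ΣΣ (λ S₀ S → f S₀ S + g S₀ S) ≡ ΣΣ f + ΣΣ g
      ΣΣ-+ f g = trans (∑-cong T₀ λ S₀ → ∑-+ T₁ (f S₀) (g S₀)) (∑-+ T₀ _ _)

      N = n ^ m₀ * n ^ m

      ΣΣ-const : ∀ c → ΣΣ (λ _ _ → c) ≡ N * c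
      ΣΣ-const c = trans (∑-cong T₀ λ _ → ∑-tuples-const n m c)
        (trans (∑-tuples-const n m₀ _) (≡.sym (*-assoc (n ^ m₀) (n ^ m) c)))

      size : ℕ
      size = suc (suc (m₀ + m))

      copies rowsMissed colsMissed rowsMissed₀ : List (Fin n) → List (Fin n) → ℕ
      copies S₀ S = ∑ V λ u → ∑ V λ v → ∑³ (u ∷ v ∷ S₀ ++ S) (D G)
      row : List (Fin n) → Fin n → ℕ
      row S u = ∑ V λ v → ind (missed? (λ x → (_⟶?_ G u x) ×-dec (b x ≟ b v)) S v)
      rowsMissed S₀ S = ∑ V (row S)
      colsMissed S₀ S = ∑ V λ v → ∑ V λ u → ind (missed? (λ t → _⟶?_ G t v) S₀ u)
      rowsMissed₀ S₀ S = n * ∑ S₀ (row S)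

    -- The vertices `u`, `v` and both samples together form one uniform tuple of length `size`.
    ∑-copies : n ^ 3 * ΣΣ copies ≤ size ^ 3 * (n ^ size * countD G)
    ∑-copies = begin
      n ^ 3 * ΣΣ copies
        ≡⟨ cong (n ^ 3 *_) rearrange ⟩
      n ^ 3 * ∑ (tuples n size) (λ S → ∑³ S (D G))
        ≤⟨ ∑-tuples-∑³ n size (D G) (λ a c → D-zero G {a} {a} {c} λ (p , _) → <-irrefl refl p)
             (λ a c → D-zero G {a} {c} {a} λ (p , q) → <-asym p q) (λ a c → D-zero G {a} {c} {c} λ (_ , q) → <-irrefl refl q) ⟩
      size ^ 3 * (n ^ size * countD G) ∎
      where
      open ≤-Reasoning
      rearrange : ΣΣ copies ≡ ∑ (tuples n size) (λ S → ∑³ S (D G))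
      rearrange = begin-equality
        ΣΣ copies
          ≡⟨ ∑-tuples-+ n m₀ m (λ S → ∑ V λ u → ∑ V λ v → ∑³ (u ∷ v ∷ S) (D G)) ⟨
        ∑ (tuples n (m₀ + m)) (λ S → ∑ V λ u → ∑ V λ v → ∑³ (u ∷ v ∷ S) (D G))
          ≡⟨ ∑-swap (tuples n (m₀ + m)) V _ ⟩
        ∑ V (λ u → ∑ (tuples n (m₀ + m)) λ S → ∑ V λ v → ∑³ (u ∷ v ∷ S) (D G))
          ≡⟨ ∑-cong V (λ u → ∑-swap (tuples n (m₀ + m)) V _) ⟩
        ∑ V (λ u → ∑ V λ v → ∑ (tuples n (m₀ + m)) λ S → ∑³ (u ∷ v ∷ S) (D G))
          ≡⟨ ∑-cong V (λ u → ∑-tuples-suc n (m₀ + m) _) ⟨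
        ∑ V (λ u → ∑ (tuples n (suc (m₀ + m))) λ S → ∑³ (u ∷ S) (D G))
          ≡⟨ ∑-tuples-suc n (suc (m₀ + m)) _ ⟨
        ∑ (tuples n size) (λ S → ∑³ S (D G)) ∎

    -- The set tested depends on `v` through its block. Summing over all `k` blocks instead makes it
    -- independent of `v`, so that `∑-missed` applies.
    ∑-row : ∀ u → suc m * ∑ T₁ (λ S → row S u) ≤ k * n ^ suc m
    ∑-row u = begin
      suc m * ∑ T₁ (λ S → row S u)
        ≤⟨ *-monoʳ-≤ (suc m) (∑-mono T₁ λ S → ∑-mono V λ v → term≤∑ (upTo k) _ (∈-upTo⁺ (b<k v))) ⟩
      suc m * ∑ T₁ (λ S → ∑ V λ v → ∑ (upTo k) λ j → ind (missed? (A? j) S v))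
        ≡⟨ cong (suc m *_) (trans (∑-cong T₁ λ S → ∑-swap V (upTo k) _) (∑-swap T₁ (upTo k) _)) ⟩
      suc m * ∑ (upTo k) (λ j → ∑ T₁ λ S → ∑ V λ v → ind (missed? (A? j) S v))
        ≡⟨ ∑-*ˡ (upTo k) (suc m) _ ⟨
      ∑ (upTo k) (λ j → suc m * ∑ T₁ λ S → ∑ V λ v → ind (missed? (A? j) S v))
        ≤⟨ ∑-mono (upTo k) (λ j → ∑-missed n m (A? j)) ⟩
      ∑ (upTo k) (λ _ → n ^ suc m)
        ≡⟨ trans (∑-const (upTo k) _) (cong (_* n ^ suc m) (length-upTo k)) ⟩
      k * n ^ suc m ∎
      where
      open ≤-Reasoning
      A? : ∀ j → Decidable (λ x → _⟶_ G u x × b x ≡ j)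
      A? j x = (_⟶?_ G u x) ×-dec (b x ≟ j)

    ∑-rowsMissed : suc m * ΣΣ rowsMissed ≤ N * (n * n * k)
    ∑-rowsMissed = begin
      suc m * ΣΣ rowsMissed
        ≡⟨ cong (suc m *_) (∑-tuples-const n m₀ _) ⟩
      suc m * (n ^ m₀ * ∑ T₁ (λ S → ∑ V (row S)))
        ≡⟨ cong (λ z → suc m * (n ^ m₀ * z)) (∑-swap T₁ V row) ⟩
      suc m * (n ^ m₀ * ∑ V (λ u → ∑ T₁ λ S → row S u))
        ≡⟨ x∙yz≡y∙xz (suc m) (n ^ m₀) _ ⟩
      n ^ m₀ * (suc m * ∑ V (λ u → ∑ T₁ λ S → row S u))
        ≡⟨ cong (n ^ m₀ *_) (∑-*ˡ V (suc m) _) ⟨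
      n ^ m₀ * ∑ V (λ u → suc m * ∑ T₁ λ S → row S u)
        ≤⟨ *-monoʳ-≤ (n ^ m₀) (∑-mono V ∑-row) ⟩
      n ^ m₀ * ∑ V (λ _ → k * n ^ suc m)
        ≡⟨ cong (n ^ m₀ *_) (∑-ones n _) ⟩
      n ^ m₀ * (n * (k * (n * n ^ m)))
        ≡⟨ collect (n ^ m₀) (n ^ m) n k ⟩
      N * (n * n * k) ∎
      where
      open ≤-Reasoning
      x∙yz≡y∙xz : ∀ x y z → x * (y * z) ≡ y * (x * z)
      x∙yz≡y∙xz = solve-∀
      collect : ∀ p q n k → p * (n * (k * (n * q))) ≡ p * q * (n * n * k)
      collect = solve-∀

    ∑-colsMissed : suc m₀ * ΣΣ colsMissed ≤ N * (n * n)
    ∑-colsMissed = begin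
      suc m₀ * ΣΣ colsMissed
        ≡⟨ cong (suc m₀ *_) (trans (∑-cong T₀ λ S₀ → ∑-tuples-const n m _) (∑-*ˡ T₀ (n ^ m) _)) ⟩
      suc m₀ * (n ^ m * ∑ T₀ (λ S₀ → ∑ V λ v → col S₀ v))
        ≡⟨ cong (λ z → suc m₀ * (n ^ m * z)) (∑-swap T₀ V col) ⟩
      suc m₀ * (n ^ m * ∑ V (λ v → ∑ T₀ λ S₀ → col S₀ v))
        ≡⟨ x∙yz≡y∙xz (suc m₀) (n ^ m) _ ⟩
      n ^ m * (suc m₀ * ∑ V (λ v → ∑ T₀ λ S₀ → col S₀ v))
        ≡⟨ cong (n ^ m *_) (∑-*ˡ V (suc m₀) _) ⟨
      n ^ m * ∑ V (λ v → suc m₀ * ∑ T₀ λ S₀ → col S₀ v)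
        ≤⟨ *-monoʳ-≤ (n ^ m) (∑-mono V λ v → ∑-missed n m₀ (λ t → _⟶?_ G t v)) ⟩
      n ^ m * ∑ V (λ _ → n ^ suc m₀)
        ≡⟨ cong (n ^ m *_) (∑-ones n _) ⟩
      n ^ m * (n * (n * n ^ m₀))
        ≡⟨ collect (n ^ m₀) (n ^ m) n ⟩
      N * (n * n) ∎
      where
      open ≤-Reasoning
      col : List (Fin n) → Fin n → ℕ
      col S₀ v = ∑ V λ u → ind (missed? (λ t → _⟶?_ G t v) S₀ u)
      x∙yz≡y∙xz : ∀ x y z → x * (y * z) ≡ y * (x * z)
      x∙yz≡y∙xz = solve-∀
      collect : ∀ p q n → q * (n * (n * p)) ≡ p * q * (n * n)
      collect = solve-∀

    -- For fixed `S₀` the sample `S` is still uniform, so `∑-row` applies to each of the `m₀`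
    -- entries of `S₀`.
    ∑-rowsMissed₀ : suc m * ΣΣ rowsMissed₀ ≤ N * (n * n * (m₀ * k))
    ∑-rowsMissed₀ = begin
      suc m * ΣΣ rowsMissed₀
        ≡⟨ ∑-*ˡ T₀ (suc m) _ ⟨
      ∑ T₀ (λ S₀ → suc m * ∑ T₁ (rowsMissed₀ S₀))
        ≤⟨ ∑-tuples-mono n m₀ single ⟩
      ∑ T₀ (λ _ → n * (m₀ * (k * n ^ suc m)))
        ≡⟨ ∑-tuples-const n m₀ _ ⟩
      n ^ m₀ * (n * (m₀ * (k * (n * n ^ m))))
        ≡⟨ collect (n ^ m₀) (n ^ m) n k m₀ ⟩
      N * (n * n * (m₀ * k)) ∎
      where
      open ≤-Reasoning
      collect : ∀ p q n k z → p * (n * (z * (k * (n * q)))) ≡ p * q * (n * n * (z * k))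
      collect = solve-∀
      x∙yz≡y∙xz : ∀ x y z → x * (y * z) ≡ y * (x * z)
      x∙yz≡y∙xz = solve-∀
      single : ∀ S₀ → length S₀ ≡ m₀ →
        suc m * ∑ T₁ (rowsMissed₀ S₀) ≤ n * (m₀ * (k * n ^ suc m))
      single S₀ refl = begin
        suc m * ∑ T₁ (λ S → n * ∑ S₀ (row S))
          ≡⟨ cong (suc m *_) (∑-*ˡ T₁ n _) ⟩
        suc m * (n * ∑ T₁ (λ S → ∑ S₀ (row S)))
          ≡⟨ cong (λ z → suc m * (n * z)) (∑-swap T₁ S₀ row) ⟩
        suc m * (n * ∑ S₀ (λ t → ∑ T₁ λ S → row S t))
          ≡⟨ x∙yz≡y∙xz (suc m) n _ ⟩
        n * (suc m * ∑ S₀ (λ t → ∑ T₁ λ S → row S t))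
          ≡⟨ cong (n *_) (∑-*ˡ S₀ (suc m) _) ⟨
        n * ∑ S₀ (λ t → suc m * ∑ T₁ λ S → row S t)
          ≤⟨ *-monoʳ-≤ n (∑-mono S₀ ∑-row) ⟩
        n * ∑ S₀ (λ _ → k * n ^ suc m)
          ≡⟨ cong (n *_) (∑-const S₀ _) ⟩
        n * (length S₀ * (k * n ^ suc m)) ∎

    ∑-cost : ΣΣ (λ S₀ S → E.cost S₀ S l block≤) ≤
      ΣΣ copies + (N * (n * l) + (ΣΣ rowsMissed + (ΣΣ colsMissed + (ΣΣ rowsMissed₀
        + N * (m₀ * (n * (l + l)))))))
    ∑-cost = begin
      ΣΣ (λ S₀ S → E.cost S₀ S l block≤)
        ≡⟨ trans (ΣΣ-+ copies _) (cong (ΣΣ copies +_)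
             (trans (ΣΣ-+ (λ _ _ → n * l) _) (cong₂ _+_ (ΣΣ-const (n * l))
             (trans (ΣΣ-+ rowsMissed _) (cong (ΣΣ rowsMissed +_)
             (trans (ΣΣ-+ colsMissed _) (cong (ΣΣ colsMissed +_)
             (ΣΣ-+ rowsMissed₀ (λ S₀ _ → length S₀ * (n * (l + l))))))))))) ⟩
      ΣΣ copies + (N * (n * l) + (ΣΣ rowsMissed + (ΣΣ colsMissed + (ΣΣ rowsMissed₀
        + ΣΣ (λ S₀ S → length S₀ * (n * (l + l)))))))
        ≤⟨ +-monoʳ-≤ (ΣΣ copies) (+-monoʳ-≤ (N * (n * l)) (+-monoʳ-≤ (ΣΣ rowsMissed)
             (+-monoʳ-≤ (ΣΣ colsMissed) (+-monoʳ-≤ (ΣΣ rowsMissed₀) lengths)))) ⟩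
      ΣΣ copies + (N * (n * l) + (ΣΣ rowsMissed + (ΣΣ colsMissed + (ΣΣ rowsMissed₀
        + N * (m₀ * (n * (l + l))))))) ∎
      where
      open ≤-Reasoning
      lengths : ΣΣ (λ S₀ _ → length S₀ * (n * (l + l))) ≤ N * (m₀ * (n * (l + l)))
      lengths = begin
        ΣΣ (λ S₀ _ → length S₀ * (n * (l + l)))
          ≤⟨ ∑-tuples-mono n m₀ (λ { S₀ refl → ≤-refl }) ⟩
        ΣΣ (λ _ _ → m₀ * (n * (l + l)))
          ≡⟨ ΣΣ-const _ ⟩
        N * (m₀ * (n * (l + l))) ∎

    module _ .{{_ : NonZero n}} (P : ℕ) .{{_ : NonZero P}} .{{_ : NonZero k}}
             (m₀+1 : suc m₀ ≡ P) (m+1 : suc m ≡ P * (k * suc m₀))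
             (k-large : P * suc (m₀ + m₀) ≤ k) (l-small : k * l ≤ 2 * n) where

      private
        instance
          N≢0 : NonZero N
          N≢0 = m*n≢0 (n ^ m₀) (n ^ m) {{m^n≢0 n m₀}} {{m^n≢0 n m}}

      n*copies : n * ΣΣ copies ≤ N * (size ^ 3 * countD G)
      n*copies = *-cancelˡ-≤ (n * n) {{m*n≢0 n n}} (begin
        n * n * (n * ΣΣ copies)                     ≡⟨ cube n (ΣΣ copies) ⟩
        n ^ 3 * ΣΣ copies                           ≤⟨ ∑-copies ⟩
        size ^ 3 * (n ^ size * countD G)            ≡⟨ cong (λ z → size ^ 3 * (n * (n * z) * countD G)) (^-distribˡ-+-* n m₀ m) ⟩
        size ^ 3 * (n * (n * N) * countD G)         ≡⟨ collect (size ^ 3) n N (countD G) ⟩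
        n * n * (N * (size ^ 3 * countD G))         ∎)
        where
        open ≤-Reasoning
        cube : ∀ n x → n * n * (n * x) ≡ n * (n * (n * 1)) * x
        cube = solve-∀
        collect : ∀ s n q c → s * (n * (n * q) * c) ≡ n * n * (q * (s * c))
        collect = solve-∀

      within : P * (N * (n * l) + N * (m₀ * (n * (l + l)))) ≤ N * (2 * (n * n))
      within = begin
        P * (N * (n * l) + N * (m₀ * (n * (l + l))))  ≡⟨ factor P N n l m₀ ⟩
        N * (n * (P * suc (m₀ + m₀) * l))              ≤⟨ *-monoʳ-≤ N (*-monoʳ-≤ n (*-monoˡ-≤ l k-large)) ⟩
        N * (n * (k * l))                              ≤⟨ *-monoʳ-≤ N (*-monoʳ-≤ n l-small) ⟩
        N * (n * (2 * n))                              ≡⟨ cong (N *_) (swap n) ⟩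
        N * (2 * (n * n))                              ∎
        where
        open ≤-Reasoning
        factor : ∀ p q n l z → p * (q * (n * l) + q * (z * (n * (l + l)))) ≡ q * (n * (p * suc (z + z) * l))
        factor = solve-∀
        swap : ∀ n → n * (2 * n) ≡ 2 * (n * n)
        swap = solve-∀

      rows : P * (ΣΣ rowsMissed + ΣΣ rowsMissed₀) ≤ N * (n * n)
      rows = *-cancelˡ-≤ (k * suc m₀) {{m*n≢0 k (suc m₀)}} (begin
        k * suc m₀ * (P * (ΣΣ rowsMissed + ΣΣ rowsMissed₀))
          ≡⟨ regroup (k * suc m₀) P _ ⟩
        P * (k * suc m₀) * (ΣΣ rowsMissed + ΣΣ rowsMissed₀)
          ≡⟨ cong (_* (ΣΣ rowsMissed + ΣΣ rowsMissed₀)) m+1 ⟨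
        suc m * (ΣΣ rowsMissed + ΣΣ rowsMissed₀)
          ≡⟨ *-distribˡ-+ (suc m) (ΣΣ rowsMissed) (ΣΣ rowsMissed₀) ⟩
        suc m * ΣΣ rowsMissed + suc m * ΣΣ rowsMissed₀
          ≤⟨ +-mono-≤ ∑-rowsMissed ∑-rowsMissed₀ ⟩
        N * (n * n * k) + N * (n * n * (m₀ * k))
          ≡⟨ collect N n k m₀ ⟩
        k * suc m₀ * (N * (n * n)) ∎)
        where
        open ≤-Reasoning
        regroup : ∀ a p x → a * (p * x) ≡ p * a * x
        regroup = solve-∀
        collect : ∀ q n k z → q * (n * n * k) + q * (n * n * (z * k)) ≡ k * suc z * (q * (n * n))
        collect = solve-∀

      cols : P * ΣΣ colsMissed ≤ N * (n * n)
      cols = subst (λ z → z * ΣΣ colsMissed ≤ N * (n * n)) m₀+1 ∑-colsMissed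

      -- Apart from copies, the average cost is at most 4n²/P: blocks and spurious pairs take two
      -- units of n²/P, forward misses one and backward misses one.
      ∑-cost-bound : n * (P * ΣΣ (λ S₀ S → E.cost S₀ S l block≤)) ≤
                     N * (P * (size ^ 3 * countD G) + 4 * (n * (n * n)))
      ∑-cost-bound = begin
        n * (P * ΣΣ (λ S₀ S → E.cost S₀ S l block≤))
          ≤⟨ *-monoʳ-≤ n (*-monoʳ-≤ P ∑-cost) ⟩
        n * (P * (ΣΣ copies + (X + (ΣΣ rowsMissed + (ΣΣ colsMissed + (ΣΣ rowsMissed₀ + Y))))))
          ≡⟨ regroup n P (ΣΣ copies) X (ΣΣ rowsMissed) (ΣΣ colsMissed) (ΣΣ rowsMissed₀) Y ⟩
        P * (n * ΣΣ copies) + n * (P * (X + Y) + P * (ΣΣ rowsMissed + ΣΣ rowsMissed₀) + P * ΣΣ colsMissed)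
          ≤⟨ +-mono-≤ (*-monoʳ-≤ P n*copies) (*-monoʳ-≤ n (+-mono-≤ (+-mono-≤ within rows) cols)) ⟩
        P * (N * (size ^ 3 * countD G)) + n * (N * (2 * (n * n)) + N * (n * n) + N * (n * n))
          ≡⟨ collect P N (size ^ 3 * countD G) n ⟩
        N * (P * (size ^ 3 * countD G) + 4 * (n * (n * n))) ∎
        where
        open ≤-Reasoning
        X = N * (n * l)
        Y = N * (m₀ * (n * (l + l)))
        regroup : ∀ n p a x r c s y → n * (p * (a + (x + (r + (c + (s + y))))))
          ≡ p * (n * a) + n * (p * (x + y) + p * (r + s) + p * c)
        regroup = solve-∀
        collect : ∀ p q d n → p * (q * d) + n * (q * (2 * (n * n)) + q * (n * n) + q * (n * n))
          ≡ q * (p * d + 4 * (n * (n * n)))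
        collect = solve-∀

      -- Averaging first over `S₀` and then over `S` fixes samples whose cost is at most the mean.
      close-DFree : ∃ λ H → InducedDFree H ×
        n * (P * dist G H) ≤ P * (size ^ 3 * countD G) + 4 * (n * (n * n))
      close-DFree with exists≤average T₀ (λ S₀ → ∑ T₁ λ S → E.cost S₀ S l block≤)
                         (subst (0 <_) (≡.sym (length-tuples n m₀)) (>-nonZero⁻¹ _ {{m^n≢0 n m₀}}))
      ... | S₀ , h₀ with exists≤average T₁ (λ S → E.cost S₀ S l block≤)
                         (subst (0 <_) (≡.sym (length-tuples n m)) (>-nonZero⁻¹ _ {{m^n≢0 n m}}))
      ... | S , h = Chain.Approx.H G b b-mono S S₀ , Chain.Approx.H-DFree G b b-mono S S₀ ,
        ≤-trans (*-monoʳ-≤ n (*-monoʳ-≤ P (E.dist≤cost S₀ S l block≤))) (*-cancelˡ-≤ N (begin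
          N * (n * (P * c))                 ≡⟨ regroup (n ^ m₀) (n ^ m) n P c ⟩
          n * (P * (n ^ m₀ * (n ^ m * c)))  ≤⟨ *-monoʳ-≤ n (*-monoʳ-≤ P average) ⟩
          n * (P * ΣΣ (λ S₀ S → E.cost S₀ S l block≤)) ≤⟨ ∑-cost-bound ⟩
          N * (P * (size ^ 3 * countD G) + 4 * (n * (n * n))) ∎))
        where
        open ≤-Reasoning
        c = E.cost S₀ S l block≤
        average : n ^ m₀ * (n ^ m * c) ≤ ΣΣ (λ S₀ S → E.cost S₀ S l block≤)
        average = subst₂ (λ x y → x * (y * c) ≤ ΣΣ (λ S₀ S → E.cost S₀ S l block≤))
          (length-tuples n m₀) (length-tuples n m) (≤-trans (*-monoʳ-≤ (length T₀) h) h₀)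
        regroup : ∀ a b n p c → a * b * (n * (p * c)) ≡ n * (p * (a * (b * c)))
        regroup = solve-∀

  -- Choice of the parameters

  m<[1+m/n]*n : ∀ m n .{{_ : NonZero n}} → m < suc (m / n) * n
  m<[1+m/n]*n m n = subst (_< suc (m / n) * n) (≡.sym (m≡m%n+[m/n]*n m n))
    (+-monoˡ-< (m / n * n) (m%n<n m n))

  block-size : ∀ n l .{{_ : NonZero l}} j → ∑ (allFin n) (λ v → ind (toℕ v / l ≟ j)) ≤ l
  block-size n l j = ≤-trans
    (∑-mono (allFin n) λ v → ind-mono (toℕ v / l ≟ j)
      ((j * l ≤? toℕ v) ×-dec (toℕ v <? j * l + l)) λ { refl →
        m/n*n≤m (toℕ v) l ,
        ≤-trans (m<[1+m/n]*n (toℕ v) l) (≤-reflexive (+-comm l _)) })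
    (interval-size n 0 (j * l) l)

  dist-self : ∀ {n} (G : OrdGraph n) → dist G G ≡ 0
  dist-self {n} G = ∑-zero (allFin n) λ u → ∑-zero (allFin n) λ v →
    cong indicator (trans (cong ((u <ᵛ v) ∧_) (Bool.xor-same (adj G u v))) (Bool.∧-zeroʳ (u <ᵛ v)))

  countD≡0⇒DFree : ∀ {n} (G : OrdGraph n) → countD G ≡ 0 → InducedDFree G
  countD≡0⇒DFree {n} G eq u v w with isD G u v w in isd
  ... | false = refl
  ... | true  = contradiction
    (≤-trans (≤-reflexive (cong indicator (≡.sym isd)))
      (≤-trans (term≤∑ V (D G u v) (∈-allFin w))
      (≤-trans (term≤∑ V (λ y → ∑ V (D G u y)) (∈-allFin v))
      (≤-trans (term≤∑ V (λ x → ∑² V (D G x)) (∈-allFin u)) (≤-reflexive eq))))) λ ()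
    where V = allFin n

  module _ (K : ℕ) .{{_ : NonZero K}} {n : ℕ} (G : OrdGraph n)
           (far : ∀ H → InducedDFree H → n * n ≤ K * dist G H) where

    private
      P k q : ℕ
      -- With this `P` the error 4n²/P is half of n²/K. Then `k` is P(P + P), as `k-large` requires,
      -- and `q` bounds the sample size P + PkP = 8K + 8192K⁴.
      P = 8 * K
      k = 128 * (K * K)
      q = 8200 * (K * (K * (K * K)))

      instance
        P≢0 : NonZero P
        P≢0 = m*n≢0 8 K
        K²≢0 : NonZero (K * K)
        K²≢0 = m*n≢0 K K
        k≢0 : NonZero k
        k≢0 = m*n≢0 128 (K * K)

      m≤m⁴ : ∀ m .{{_ : NonZero m}} → m ≤ m * (m * (m * m))
      m≤m⁴ m = ≤-trans (≤-reflexive (≡.sym (*-identityʳ m)))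
        (*-monoʳ-≤ m (>-nonZero⁻¹ _ {{m*n≢0 m (m * m) {{it}} {{m*n≢0 m m}}}}))

      k≤q : k ≤ q
      k≤q = *-mono-≤ (≤ᵇ⇒≤ 128 8200 _) (begin
        K * K              ≤⟨ m≤m*n (K * K) (K * K) ⟩
        K * K * (K * K)    ≡⟨ *-assoc K K (K * K) ⟩
        K * (K * (K * K))  ∎)
        where open ≤-Reasoning

      sum≤q : P + P * (k * P) ≤ q
      sum≤q = begin
        P + P * (k * P)                      ≡⟨ cong (P +_) (expand 8 128 K) ⟩
        P + 8 * 128 * 8 * (K * (K * (K * K)))  ≤⟨ +-monoˡ-≤ _ (*-monoʳ-≤ 8 (m≤m⁴ K)) ⟩
        8 * (K * (K * (K * K))) + 8 * 128 * 8 * (K * (K * (K * K)))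
                                             ≡⟨ *-distribʳ-+ (K * (K * (K * K))) 8 (8 * 128 * 8) ⟨
        q                                    ∎
        where
        open ≤-Reasoning
        expand : ∀ a b x → a * x * (b * (x * x) * (a * x)) ≡ a * b * a * (x * (x * (x * x)))
        expand = solve-∀

      Goal : Set
      Goal = n * (n * n) ≤ 2 * K * (q ^ 3 * countD G)

      -- Without copies `G` is at distance 0 from a `D`-free graph, itself, which forces n = 0;
      -- otherwise a single copy outweighs n³ ≤ q³.
      small : n ≤ k → Goal
      small n≤k with countD G in eq
      ... | zero = ≤-trans (*-monoʳ-≤ n (≤-trans (far G (countD≡0⇒DFree G eq))
                     (≤-reflexive (trans (cong (K *_) (dist-self G)) (*-zeroʳ K)))))
                     (≤-trans (≤-reflexive (*-zeroʳ n)) z≤n)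
      ... | suc c = begin
        n * (n * n)              ≡⟨ cong (λ z → n * (n * z)) (*-identityʳ n) ⟨
        n ^ 3                    ≤⟨ ^-monoˡ-≤ 3 (≤-trans n≤k k≤q) ⟩
        q ^ 3                    ≤⟨ m≤m*n (q ^ 3) (suc c) ⟩
        q ^ 3 * suc c            ≤⟨ m≤n*m (q ^ 3 * suc c) (2 * K) {{m*n≢0 2 K}} ⟩
        2 * K * (q ^ 3 * suc c)  ∎
        where open ≤-Reasoning

      -- The approximation error uses up half of the distance guaranteed by `far`; after it is
      -- cancelled, copies must account for the other half.
      large : k < n → Goal
      large k<n = *-cancelˡ-≤ (4 * K) {{m*n≢0 4 K}} (+-cancelʳ-≤ _ _ _ (begin
        4 * K * (n * (n * n)) + K * (4 * (n * (n * n)))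
          ≡⟨ double K n ⟩
        n * (P * (n * n))
          ≤⟨ *-monoʳ-≤ n (*-monoʳ-≤ P (far H H-free)) ⟩
        n * (P * (K * dist G H))
          ≡⟨ regroup n P K (dist G H) ⟩
        K * (n * (P * dist G H))
          ≤⟨ *-monoʳ-≤ K close ⟩
        K * (P * (suc (suc (m₀ + m)) ^ 3 * countD G) + 4 * (n * (n * n)))
          ≤⟨ *-monoʳ-≤ K (+-monoˡ-≤ _ (*-monoʳ-≤ P (*-monoˡ-≤ (countD G) (^-monoˡ-≤ 3 size≤q)))) ⟩
        K * (P * (q ^ 3 * countD G) + 4 * (n * (n * n)))
          ≡⟨ collect K (q ^ 3 * countD G) (4 * (n * (n * n))) ⟩
        4 * K * (2 * K * (q ^ 3 * countD G)) + K * (4 * (n * (n * n))) ∎))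
        where
        open ≤-Reasoning
        instance
          n≢0 : NonZero n
          n≢0 = >-nonZero (≤-<-trans z≤n k<n)
          kP≢0 : NonZero (P * (k * P))
          kP≢0 = m*n≢0 P (k * P) {{P≢0}} {{m*n≢0 k P}}
        m₀ m l : ℕ
        m₀ = pred P
        m = pred (P * (k * P))
        -- Rounding up gives n < kl, so block indices stay below `k`; the excess of kl over n is at
        -- most `k`, hence less than n.
        l = suc (n / k)
        m₀+1 : suc m₀ ≡ P
        m₀+1 = suc-pred P
        m+1 : suc m ≡ P * (k * suc m₀)
        m+1 = trans (suc-pred (P * (k * P))) (cong (λ z → P * (k * z)) (≡.sym m₀+1))
        size≤q : suc (suc (m₀ + m)) ≤ q
        size≤q = begin
          suc (suc (m₀ + m))  ≡⟨ cong suc (+-suc m₀ m) ⟨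
          suc m₀ + suc m      ≡⟨ cong₂ _+_ m₀+1 (suc-pred (P * (k * P))) ⟩
          P + P * (k * P)     ≤⟨ sum≤q ⟩
          q                   ∎
        k-large : P * suc (m₀ + m₀) ≤ k
        k-large = begin
          P * suc (m₀ + m₀)     ≤⟨ *-monoʳ-≤ P (s≤s (+-monoʳ-≤ m₀ (n≤1+n m₀))) ⟩
          P * (suc m₀ + suc m₀) ≡⟨ cong (λ z → P * (z + z)) m₀+1 ⟩
          P * (P + P)           ≡⟨ expand K ⟩
          k                     ∎
          where
          expand : ∀ x → 8 * x * (8 * x + 8 * x) ≡ 128 * (x * x)
          expand = solve-∀
        l-small : k * l ≤ 2 * n
        l-small = begin
          k * suc (n / k)    ≡⟨ *-suc k (n / k) ⟩
          k + k * (n / k)    ≤⟨ +-mono-≤ (<⇒≤ k<n) (≤-trans (≤-reflexive (*-comm k (n / k))) (m/n*n≤m n k)) ⟩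
          n + n              ≡⟨ cong (n +_) (+-identityʳ n) ⟨
          2 * n              ∎
        blocks<k : ∀ v → toℕ v / l < k
        blocks<k v = m<n*o⇒m/o<n (<-≤-trans (Fin.toℕ<n v) (<⇒≤
          (<-≤-trans (m<[1+m/n]*n n k) (≤-reflexive (*-comm l k)))))
        approximation = Average.close-DFree G (λ v → toℕ v / l) (λ u≤v → /-monoˡ-≤ l u≤v)
          k blocks<k l (block-size n l) m₀ m P m₀+1 m+1 k-large l-small
        H = proj₁ approximation
        H-free = proj₁ (proj₂ approximation)
        close = proj₂ (proj₂ approximation)
        double : ∀ x n → 4 * x * (n * (n * n)) + x * (4 * (n * (n * n))) ≡ n * (8 * x * (n * n))
        double = solve-∀
        regroup : ∀ n p x d → n * (p * (x * d)) ≡ x * (n * (p * d))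
        regroup = solve-∀
        collect : ∀ x y z → x * (8 * x * y + z) ≡ 4 * x * (2 * x * y) + x * z
        collect = solve-∀

    -- The exponent 13 is 12 from the cube of `q`, of order K⁴, plus 1 from the factor 2K.
    many-copies : n ^ 3 ≤ 2 * 8200 ^ 3 * K ^ 13 * countD G
    many-copies = begin
      n ^ 3                               ≡⟨ cong (λ z → n * (n * z)) (*-identityʳ n) ⟩
      n * (n * n)                         ≤⟨ goal ⟩
      2 * K * (q ^ 3 * countD G)          ≡⟨ expand 8200 K (countD G) ⟩
      2 * 8200 ^ 3 * K ^ 13 * countD G    ∎
      where
      open ≤-Reasoning
      goal : Goal
      goal with n ≤? k
      ... | yes n≤k = small n≤k
      ... | no n≰k  = large (≰⇒> n≰k)
      expand : ∀ s x c → 2 * x * ((s * (x * (x * (x * x)))) ^ 3 * c) ≡ 2 * s ^ 3 * x ^ 13 * c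
      expand s x c = ring s x c
        where
        ring : ∀ s x c →
          2 * x * ((s * (x * (x * (x * x)))) * ((s * (x * (x * (x * x)))) * ((s * (x * (x * (x * x)))) * 1)) * c)
          ≡ 2 * (s * (s * (s * 1)))
            * (x * (x * (x * (x * (x * (x * (x * (x * (x * (x * (x * (x * (x * 1))))))))))))) * c
        ring = solve-∀

-- From natural numbers to rational ε

open Counting using (m<[1+m/n]*n; many-copies)
open import Algebra.Bundles using (CommutativeMonoid)
import Data.Integer as ℤ
import Data.Integer.Properties as ℤ
open import Data.Nat using (suc; NonZero)
import Data.Nat as ℕ
import Data.Nat.DivMod as ℕ
import Data.Nat.Properties as ℕ
open import Data.Product using (∃; _,_)
open import Data.Rational using (ℚ; _<_; _≤_; _*_; 0ℚ; 1ℚ)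
import Data.Rational as ℚ
import Data.Rational.Properties as ℚ
import Data.Rational.Unnormalised as ℚᵘ
import Data.Rational.Unnormalised.Properties as ℚᵘ
open import Algebra.Properties.CommutativeSemigroup
  (CommutativeMonoid.commutativeSemigroup ℚ.*-1-commutativeMonoid) using (interchange)
open import Relation.Binary.PropositionalEquality hiding (sym)
import Relation.Binary.PropositionalEquality as ≡

-- The fraction k/1, where 0 encodes the denominator 1. Division in ℚ normalises by a gcd; in this
-- unnormalised form numerators can be compared directly.
fromℕ : ℕ → ℚᵘ.ℚᵘ
fromℕ k = ℚᵘ.mkℚᵘ (ℤ.+ k) 0

toℚᵘ-ℕtoℚ : ∀ k → ℚ.toℚᵘ (ℕtoℚ k) ℚᵘ.≃ fromℕ k
toℚᵘ-ℕtoℚ k = ℚ.toℚᵘ-fromℚᵘ (fromℕ k)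

ℕtoℚ-* : ∀ a b → ℕtoℚ (a ℕ.* b) ≡ ℕtoℚ a * ℕtoℚ b
ℕtoℚ-* a b = ℚ.toℚᵘ-injective (begin
  ℚ.toℚᵘ (ℕtoℚ (a ℕ.* b))                    ≈⟨ toℚᵘ-ℕtoℚ (a ℕ.* b) ⟩
  fromℕ (a ℕ.* b)                            ≡⟨ cong (λ z → ℚᵘ.mkℚᵘ z 0) (ℤ.pos-* a b) ⟩
  fromℕ a ℚᵘ.* fromℕ b                       ≈⟨ ℚᵘ.*-cong (toℚᵘ-ℕtoℚ a) (toℚᵘ-ℕtoℚ b) ⟨
  ℚ.toℚᵘ (ℕtoℚ a) ℚᵘ.* ℚ.toℚᵘ (ℕtoℚ b)       ≈⟨ ℚ.toℚᵘ-homo-* (ℕtoℚ a) (ℕtoℚ b) ⟨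
  ℚ.toℚᵘ (ℕtoℚ a * ℕtoℚ b)                   ∎)
  where open ℚᵘ.≃-Reasoning

ℕtoℚ-^ : ∀ a e → ℕtoℚ (a ℕ.^ e) ≡ ℕtoℚ a ^ℚ e
ℕtoℚ-^ a ℕ.zero  = refl
ℕtoℚ-^ a (suc e) = trans (ℕtoℚ-* a (a ℕ.^ e)) (cong (ℕtoℚ a *_) (ℕtoℚ-^ a e))

ℕtoℚ-mono-≤ : ∀ {a b} → a ℕ.≤ b → ℕtoℚ a ≤ ℕtoℚ b
ℕtoℚ-mono-≤ {a} {b} a≤b = ℚ.toℚᵘ-cancel-≤
  (ℚᵘ.≤-respˡ-≃ (ℚᵘ.≃-sym (toℚᵘ-ℕtoℚ a)) (ℚᵘ.≤-respʳ-≃ (ℚᵘ.≃-sym (toℚᵘ-ℕtoℚ b))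
    (ℚᵘ.*≤* (ℤ.*-monoʳ-≤-nonNeg (ℤ.+ 1) (ℤ.+≤+ a≤b)))))

ℕtoℚ-cancel-≤ : ∀ {a b} → ℕtoℚ a ≤ ℕtoℚ b → a ℕ.≤ b
ℕtoℚ-cancel-≤ {a} {b} h with ℚᵘ.≤-respˡ-≃ (toℚᵘ-ℕtoℚ a) (ℚᵘ.≤-respʳ-≃ (toℚᵘ-ℕtoℚ b) (ℚ.toℚᵘ-mono-≤ h))
... | ℚᵘ.*≤* a≤b = ℤ.drop‿+≤+ (ℤ.*-cancelʳ-≤-pos (ℤ.+ a) (ℤ.+ b) (ℤ.+ 1) a≤b)

ℕtoℚ-nonNeg : ∀ a → ℚ.NonNegative (ℕtoℚ a)
ℕtoℚ-nonNeg a = ℚ.nonNegative (ℕtoℚ-mono-≤ {0} {a} ℕ.z≤n)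

ℕtoℚ-pos : ∀ a .{{_ : NonZero a}} → ℚ.Positive (ℕtoℚ a)
ℕtoℚ-pos a@(suc _) = ℚ.positive (ℚ.<-≤-trans (ℚ.positive⁻¹ 1ℚ) (ℕtoℚ-mono-≤ {1} {a} (ℕ.s≤s ℕ.z≤n)))

^ℚ-distrib-* : ∀ x y e → (x * y) ^ℚ e ≡ x ^ℚ e * y ^ℚ e
^ℚ-distrib-* x y ℕ.zero  = refl
^ℚ-distrib-* x y (suc e) =
  trans (cong (x * y *_) (^ℚ-distrib-* x y e)) (interchange x y (x ^ℚ e) (y ^ℚ e))

^ℚ-nonNeg : ∀ x .{{_ : ℚ.NonNegative x}} e → ℚ.NonNegative (x ^ℚ e)
^ℚ-nonNeg x ℕ.zero  = _
^ℚ-nonNeg x (suc e) = ℚ.nonNeg*nonNeg⇒nonNeg x (x ^ℚ e) {{^ℚ-nonNeg x e}}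

^ℚ-pos : ∀ x .{{_ : ℚ.Positive x}} e → ℚ.Positive (x ^ℚ e)
^ℚ-pos x ℕ.zero  = _
^ℚ-pos x (suc e) = ℚ.pos*pos⇒pos x (x ^ℚ e) {{^ℚ-pos x e}}

^ℚ-mono-≤ : ∀ {x y} .{{_ : ℚ.NonNegative x}} .{{_ : ℚ.NonNegative y}} → x ≤ y → ∀ e → x ^ℚ e ≤ y ^ℚ e
^ℚ-mono-≤ x≤y ℕ.zero  = ℚ.≤-refl
^ℚ-mono-≤ {x} {y} x≤y (suc e) = ℚ.≤-trans
  (ℚ.*-monoˡ-≤-nonNeg x (^ℚ-mono-≤ x≤y e))
  (ℚ.*-monoʳ-≤-nonNeg (y ^ℚ e) {{^ℚ-nonNeg y e}} x≤y)

-- The witness is ⌊1/ε⌋ + 1, so that 1 < εK ≤ 1 + ε < 2.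
reciprocal-scale : ∀ ε → 0ℚ < ε → ε < 1ℚ →
  ∃ λ K → NonZero K × 1ℚ ≤ ε * ℕtoℚ K × ε * ℕtoℚ K ≤ ℕtoℚ 2
reciprocal-scale ε@(ℚ.mkℚ (ℤ.+ suc p) d _) _ (ℚ.*<* ε<1) = K , _ ,
  ℚ.toℚᵘ-cancel-≤ (ℚᵘ.≤-respʳ-≃ (ℚᵘ.≃-sym product)
    (ℚᵘ.*≤* (ℤ.+≤+ (subst₂ ℕ._≤_ (≡.sym (trans (ℕ.*-identityˡ _) (ℕ.*-identityʳ (suc d))))
      (≡.sym (ℕ.*-identityʳ (suc p ℕ.* K))) lower)))) ,
  ℚ.toℚᵘ-cancel-≤ (ℚᵘ.≤-respˡ-≃ (ℚᵘ.≃-sym product)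
    (ℚᵘ.*≤* (ℤ.+≤+ (subst₂ ℕ._≤_ (≡.sym (ℕ.*-identityʳ (suc p ℕ.* K)))
      (cong (2 ℕ.*_) (≡.sym (ℕ.*-identityʳ (suc d)))) upper))))
  where
  q = suc d
  K = suc (q ℕ./ suc p)
  product : ℚ.toℚᵘ (ε * ℕtoℚ K) ℚᵘ.≃ ℚ.toℚᵘ ε ℚᵘ.* fromℕ K
  product = ℚᵘ.≃-trans (ℚ.toℚᵘ-homo-* ε (ℕtoℚ K)) (ℚᵘ.*-congˡ {ℚ.toℚᵘ ε} (toℚᵘ-ℕtoℚ K))
  lower : q ℕ.≤ suc p ℕ.* K
  lower = ℕ.≤-trans (ℕ.<⇒≤ (m<[1+m/n]*n q (suc p))) (ℕ.≤-reflexive (ℕ.*-comm K (suc p)))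
  p<q : suc p ℕ.≤ q
  p<q = ℕ.<⇒≤ (ℤ.drop‿+<+ (subst₂ ℤ._<_ (ℤ.*-identityʳ _) (ℤ.*-identityˡ _) ε<1))
  upper : suc p ℕ.* K ℕ.≤ 2 ℕ.* q
  upper = begin
    suc p ℕ.* K                             ≡⟨ ℕ.*-suc (suc p) (q ℕ./ suc p) ⟩
    suc p ℕ.+ suc p ℕ.* (q ℕ./ suc p)       ≡⟨ cong (suc p ℕ.+_) (ℕ.*-comm (suc p) (q ℕ./ suc p)) ⟩
    suc p ℕ.+ q ℕ./ suc p ℕ.* suc p         ≤⟨ ℕ.+-mono-≤ p<q (ℕ.m/n*n≤m q (suc p)) ⟩
    q ℕ.+ q                                 ≡⟨ cong (q ℕ.+_) (ℕ.+-identityʳ q) ⟨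
    2 ℕ.* q                                 ∎
    where open ℕ.≤-Reasoning
reciprocal-scale (ℚ.mkℚ (ℤ.+ 0) d _) (ℚ.*<* (ℤ.+<+ ())) _
reciprocal-scale (ℚ.mkℚ ℤ.-[1+ _ ] d _) (ℚ.*<* ()) _

module _ (C : ℚ) {{C>0 : ℚ.Positive C}} (t : ℚ) {{t>0 : ℚ.Positive t}} (e : ℕ) where

  private
    Z = C * t ^ℚ e
    instance
      Z>0 : ℚ.Positive Z
      Z>0 = ℚ.pos*pos⇒pos C (t ^ℚ e) {{^ℚ-pos t e}}

  -- In `density-bound` the product of `x ^ℚ e` and `k ^ℚ e` is at most `t ^ℚ e`; this reciprocal
  -- cancels that power together with `C`.
  density : ℚ
  density = (ℚ.1/ Z) {{ℚ.pos⇒nonZero Z}}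

  density-pos : ℚ.Positive density
  density-pos = ℚ.1/pos⇒pos Z

  density-bound : ∀ x k D N .{{_ : ℚ.NonNegative x}} .{{_ : ℚ.NonNegative k}} .{{_ : ℚ.NonNegative D}} →
    x * k ≤ t → N ≤ C * k ^ℚ e * D → density * x ^ℚ e * N ≤ D
  density-bound x k D N xk≤t N≤ = begin
    density * x ^ℚ e * N
      ≤⟨ ℚ.*-monoˡ-≤-nonNeg (density * x ^ℚ e) {{ℚ.nonNeg*nonNeg⇒nonNeg density {{ℚ.pos⇒nonNeg density {{density-pos}}}} (x ^ℚ e) {{^ℚ-nonNeg x e}}}} N≤ ⟩
    density * x ^ℚ e * (C * k ^ℚ e * D)
      ≡⟨ ℚ.*-assoc (density * x ^ℚ e) (C * k ^ℚ e) D ⟨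
    density * x ^ℚ e * (C * k ^ℚ e) * D
      ≡⟨ cong (_* D) (interchange density (x ^ℚ e) C (k ^ℚ e)) ⟩
    density * C * (x ^ℚ e * k ^ℚ e) * D
      ≡⟨ cong (λ z → density * C * z * D) (^ℚ-distrib-* x k e) ⟨
    density * C * (x * k) ^ℚ e * D
      ≤⟨ ℚ.*-monoʳ-≤-nonNeg D (ℚ.*-monoˡ-≤-nonNeg (density * C) {{ℚ.pos⇒nonNeg (density * C) {{ℚ.pos*pos⇒pos density {{density-pos}} C}}}}
           (^ℚ-mono-≤ {{ℚ.nonNeg*nonNeg⇒nonNeg x k}} {{ℚ.pos⇒nonNeg t}} xk≤t e)) ⟩
    density * C * t ^ℚ e * D
      ≡⟨ cong (_* D) (ℚ.*-assoc density C (t ^ℚ e)) ⟩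
    density * Z * D
      ≡⟨ cong (_* D) (ℚ.*-inverseˡ Z {{ℚ.pos⇒nonZero Z}}) ⟩
    1ℚ * D
      ≡⟨ ℚ.*-identityˡ D ⟩
    D ∎
    where open ℚ.≤-Reasoning

far⇒dist : ∀ {n} (G : OrdGraph n) ε K → 1ℚ ≤ ε * ℕtoℚ K → EpsFar ε G →
           ∀ H → InducedDFree H → n ℕ.* n ℕ.≤ K ℕ.* dist G H
far⇒dist {n} G ε K 1≤εK far H free = ℕtoℚ-cancel-≤ (begin
  ℕtoℚ (n ℕ.* n)                    ≡⟨ cong (λ z → ℕtoℚ (n ℕ.* z)) (ℕ.*-identityʳ n) ⟨
  ℕtoℚ (n ℕ.^ 2)                    ≡⟨ ℕtoℚ-^ n 2 ⟩
  N²                                ≡⟨ ℚ.*-identityˡ N² ⟨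
  1ℚ * N²                           ≤⟨ ℚ.*-monoʳ-≤-nonNeg N² {{^ℚ-nonNeg (ℕtoℚ n) {{ℕtoℚ-nonNeg n}} 2}} 1≤εK ⟩
  ε * ℕtoℚ K * N²                   ≡⟨ cong (_* N²) (ℚ.*-comm ε (ℕtoℚ K)) ⟩
  ℕtoℚ K * ε * N²                   ≡⟨ ℚ.*-assoc (ℕtoℚ K) ε N² ⟩
  ℕtoℚ K * (ε * N²)                 ≤⟨ ℚ.*-monoˡ-≤-nonNeg (ℕtoℚ K) {{ℕtoℚ-nonNeg K}} (far H free) ⟩
  ℕtoℚ K * ℕtoℚ (dist G H)          ≡⟨ ℕtoℚ-* K (dist G H) ⟨
  ℕtoℚ (K ℕ.* dist G H)             ∎)
  where
  open ℚ.≤-Reasoning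
  N² = ℕtoℚ n ^ℚ 2

-- Here `K` stands for 1/ε up to a factor 2. Keeping `C` and `e` as variables leaves the large
-- numerals out of the rational arithmetic.
rational-removal : ∀ C .{{_ : NonZero C}} e →
  (∀ K .{{_ : NonZero K}} {n} (G : OrdGraph n) →
    (∀ H → InducedDFree H → n ℕ.* n ℕ.≤ K ℕ.* dist G H) → n ℕ.^ 3 ℕ.≤ C ℕ.* K ℕ.^ e ℕ.* countD G) →
  Σ ℚ λ c → 0ℚ < c × (∀ ε → 0ℚ < ε → ε < 1ℚ → ∀ n (G : OrdGraph n) → EpsFar ε G →
    (c * (ε ^ℚ e)) * (ℕtoℚ n ^ℚ 3) ≤ ℕtoℚ (countD G))
rational-removal C e removal = c , ℚ.positive⁻¹ c {{density-pos (ℕtoℚ C) (ℕtoℚ 2) e}} , bound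
  where
  instance
    C>0 : ℚ.Positive (ℕtoℚ C)
    C>0 = ℕtoℚ-pos C
  c : ℚ
  c = density (ℕtoℚ C) (ℕtoℚ 2) e
  bound : ∀ ε → 0ℚ < ε → ε < 1ℚ → ∀ n (G : OrdGraph n) → EpsFar ε G →
    (c * (ε ^ℚ e)) * (ℕtoℚ n ^ℚ 3) ≤ ℕtoℚ (countD G)
  bound ε 0<ε ε<1 n G far = let K , K≢0 , 1≤εK , εK≤2 = reciprocal-scale ε 0<ε ε<1 in
    density-bound (ℕtoℚ C) (ℕtoℚ 2) e
    ε (ℕtoℚ K) (ℕtoℚ (countD G)) (ℕtoℚ n ^ℚ 3)
    {{ℚ.nonNegative (ℚ.<⇒≤ 0<ε)}} {{ℕtoℚ-nonNeg K}} {{ℕtoℚ-nonNeg (countD G)}} εK≤2 (begin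
      ℕtoℚ n ^ℚ 3
        ≡⟨ ℕtoℚ-^ n 3 ⟨
      ℕtoℚ (n ℕ.^ 3)
        ≤⟨ ℕtoℚ-mono-≤ (removal K {{K≢0}} G (far⇒dist G ε K 1≤εK far)) ⟩
      ℕtoℚ (C ℕ.* K ℕ.^ e ℕ.* countD G)
        ≡⟨ trans (ℕtoℚ-* (C ℕ.* K ℕ.^ e) (countD G)) (cong (_* ℕtoℚ (countD G))
             (trans (ℕtoℚ-* C (K ℕ.^ e)) (cong (ℕtoℚ C *_) (ℕtoℚ-^ K e)))) ⟩
      ℕtoℚ C * ℕtoℚ K ^ℚ e * ℕtoℚ (countD G) ∎)
    where open ℚ.≤-Reasoning

theorem2p1 : Σ ℕ (λ c → Σ ℚ (λ c' → (0 Data.Nat.< c) × (0ℚ < c') ×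
    (∀ (ε : ℚ) → 0ℚ < ε → ε < 1ℚ → ∀ (n : ℕ) (G : OrdGraph n) →
    EpsFar ε G →
    (c' * (ε ^ℚ c)) * (ℕtoℚ n ^ℚ 3) ≤ ℕtoℚ (countD G))))
theorem2p1 = let c' , c'>0 , bound = rational-removal (2 ℕ.* 8200 ℕ.^ 3) 13 many-copies
             -- The constant `c'` is the reciprocal of 2 · 8200³ · 2¹³, the last factor coming from
             -- εK ≤ 2.
             in 13 , c' , ℕ.z<s , c'>0 , bound
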